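{- For every fixed positive integer $k$, the approximation ratio of the $k$-Opt algorithm and the approximation ratio of the $k$-improv algorithm for the \textsc{(1,2)-TSP} are at least $\frac{11}{10}$; that is, for every $\epsilon>0$ there is a \textsc{(1,2)-TSP} instance and a possible output tour of the respective algorithm whose length is at least $\left(\frac{11}{10}-\epsilon\right)$ times the optimal tour length.
   Context: In the \textsc{(1,2)-TSP} every edge of the complete graph $K_n$ has cost 1 or 2; a tour is a Hamiltonian cycle. A $k$-move replaces at most $k$ edges of a tour by other edges to obtain a new tour; the $k$-Opt algorithm starts from an arbitrary tour and performs $k$-moves that shorten the tour while possible (its outputs are the $k$-optimal tours). A 2-matching is a vertex-disjoint union of paths and cycles; a singleton is a vertex of degree 0. A $k$-improv-move deletes and adds in total at most $k$ edges of a 2-matching to obtain a new 2-matching; it is improving if the resulting 2-matching $\widetilde{T'}$ contains only cost-1 edges and, compared to the current 2-matching $\widetilde T$, either has fewer connected components, or the same number of components and more cycles, or the same numbers of components and cycles and fewer singletons. The $k$-improv algorithm starts with an arbitrary tour, removes all cost-2 edges to get a 2-matching $\widetilde T$, performs improving $k$-improv-moves while possible, then removes an arbitrary edge from each cycle of $\widetilde T$ and connects the resulting paths arbitrarily into a tour, which it outputs. The approximation ratio of an algorithm is the supremum, over instances and all possible outputs (any initial tour, any choices), of output length divided by optimal tour length. -}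

module Defs where

open import Data.Nat using (ℕ; zero; suc; _+_; _≤_; _<_; _≡ᵇ_; _<ᵇ_; _≤ᵇ_)
open import Data.Fin using (Fin; toℕ; _≟_)
import Data.Fin as F
open import Data.Bool using (Bool; true; false; _∧_; _∨_; not; if_then_else_)
open import Data.Integer using (+_)
open import Data.Rational using (ℚ; _/_; _-_; _*_) renaming (_≤_ to _≤ℚ_)
open import Data.Product using (Σ; _×_; ∃)
open import Data.Sum using (_⊎_)
open import Relation.Nullary using (¬_; ⌊_⌋)
open import Relation.Binary.PropositionalEquality using (_≡_; _≢_)

sumFin : ∀ {n} → (Fin n → ℕ) → ℕ
sumFin {zero}  f = 0
sumFin {suc n} f = f F.zero + sumFin (λ i → f (F.suc i))

anyFin : ∀ {n} → (Fin n → Bool) → Bool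
anyFin {zero}  p = false
anyFin {suc n} p = p F.zero ∨ anyFin (λ i → p (F.suc i))

allFin : ∀ {n} → (Fin n → Bool) → Bool
allFin {zero}  p = true
allFin {suc n} p = p F.zero ∧ allFin (λ i → p (F.suc i))

countFin : ∀ {n} → (Fin n → Bool) → ℕ
countFin p = sumFin (λ i → if p i then 1 else 0)

-- Graphs on vertex set Fin n, given by a Boolean adjacency relation.
-- (Meaningful when symmetric and irreflexive; edges = unordered pairs.)

Graph : ℕ → Set
Graph n = Fin n → Fin n → Bool

module _ {n : ℕ} where

  countPairs : Graph n → ℕ
  countPairs A = sumFin λ u → sumFin λ v → if (toℕ u <ᵇ toℕ v) ∧ A u v then 1 else 0

  cost : (Fin n → Fin n → ℕ) → Graph n → ℕ
  cost c A = sumFin λ u → sumFin λ v → if (toℕ u <ᵇ toℕ v) ∧ A u v then c u v else 0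

  diff : Graph n → Graph n → ℕ
  diff A B = countPairs (λ u v → A u v ∧ not (B u v))

  deg : Graph n → Fin n → ℕ
  deg A u = countFin (A u)

  reachB : Graph n → ℕ → Fin n → Fin n → Bool
  reachB A zero    u v = ⌊ u ≟ v ⌋
  reachB A (suc m) u v = reachB A m u v ∨ anyFin (λ w → reachB A m u w ∧ A w v)

  -- u and v lie in the same connected component (walks of length ≤ n suffice)
  conn : Graph n → Fin n → Fin n → Bool
  conn A u v = reachB A n u v

  isRep : Graph n → Fin n → Bool
  isRep A v = allFin (λ u → not (conn A u v) ∨ (toℕ v ≤ᵇ toℕ u))

  -- every vertex in the component of v has degree 2, i.e. (in a 2-matching)
  -- the component of v is a cycle
  inCycle : Graph n → Fin n → Bool
  inCycle A v = allFin (λ u → not (conn A u v) ∨ (deg A u ≡ᵇ 2))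

  components : Graph n → ℕ
  components A = countFin (isRep A)

  cycles : Graph n → ℕ
  cycles A = countFin (λ v → isRep A v ∧ inCycle A v)

  singletons : Graph n → ℕ
  singletons A = countFin (λ v → deg A v ≡ᵇ 0)

  IsSimple : Graph n → Set
  IsSimple A = (∀ u v → A u v ≡ A v u) × (∀ u → A u u ≡ false)

  Is2Matching : Graph n → Set
  Is2Matching A = IsSimple A × (∀ u → deg A u ≤ 2)

  -- tour: Hamiltonian cycle = connected spanning 2-regular simple subgraph
  IsTour : Graph n → Set
  IsTour A = IsSimple A × (∀ u → deg A u ≡ 2) × (∀ u v → conn A u v ≡ true)

record Instance : Set where
  field
    n     : ℕ
    3≤n   : 3 ≤ n
    c     : Fin n → Fin n → ℕ
    c-sym : ∀ u v → c u v ≡ c v u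
    c-12  : ∀ u v → u ≢ v → (c u v ≡ 1) ⊎ (c u v ≡ 2)

open Instance public

tourCost : (I : Instance) → Graph (n I) → ℕ
tourCost I T = cost (c I) T

-- k-Opt: its possible outputs are exactly the k-optimal tours

KMove : (I : Instance) → ℕ → Graph (n I) → Graph (n I) → Set
KMove I k T T' = IsTour T' × diff T T' ≤ k

KOptimal : (I : Instance) → ℕ → Graph (n I) → Set
KOptimal I k T = IsTour T ×
  (∀ T' → KMove I k T T' → ¬ (tourCost I T' < tourCost I T))

AllCost1 : (I : Instance) → Graph (n I) → Set
AllCost1 I A = ∀ u v → A u v ≡ true → c I u v ≡ 1

cost1Part : (I : Instance) → Graph (n I) → Graph (n I)
cost1Part I T u v = T u v ∧ (c I u v ≡ᵇ 1)

Better : ∀ {n} → Graph n → Graph n → Set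
Better A B =
  (components B < components A) ⊎
  ((components B ≡ components A) × (cycles A < cycles B)) ⊎
  ((components B ≡ components A) × (cycles B ≡ cycles A) × (singletons B < singletons A))

ImprovingMove : (I : Instance) → ℕ → Graph (n I) → Graph (n I) → Set
ImprovingMove I k A B =
  Is2Matching B × (diff A B + diff B A ≤ k) × AllCost1 I B × Better A B

data Run (I : Instance) (k : ℕ) : Graph (n I) → Graph (n I) → Set where
  done : ∀ {A} → Run I k A A
  step : ∀ {A B C} → ImprovingMove I k A B → Run I k B C → Run I k A C

OneEdgePerCycle : ∀ {n} → Graph n → Graph n → Set
OneEdgePerCycle {n} A R =
  (∀ u v → R u v ≡ R v u) ×
  (∀ u v → R u v ≡ true → A u v ≡ true) ×
  (∀ u v → R u v ≡ true → inCycle A u ≡ true) ×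
  (∀ w → inCycle A w ≡ true → countPairs (λ x y → R x y ∧ conn A x w) ≡ 1)

ImprovOutput : (I : Instance) → ℕ → Graph (n I) → Set
ImprovOutput I k T =
  Σ (Graph (n I)) λ T₀ → IsTour T₀ ×
  Σ (Graph (n I)) λ A → Run I k (cost1Part I T₀) A ×
  (∀ B → ¬ ImprovingMove I k A B) ×
  Σ (Graph (n I)) λ R → OneEdgePerCycle A R ×
  IsTour T × (∀ u v → A u v ≡ true → R u v ≡ false → T u v ≡ true)

ℕtoℚ : ℕ → ℚ
ℕtoℚ m = + m / 1

RatioAtLeast : (I : Instance) → Graph (n I) → ℚ → Set
RatioAtLeast I T ε =
  Σ (Graph (n I)) λ O → IsTour O ×
  (∀ T' → IsTour T' → tourCost I O ≤ tourCost I T') ×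
  (((+ 11 / 10) - ε) * ℕtoℚ (tourCost I O) ≤ℚ ℕtoℚ (tourCost I T))

-- Take a 4-regular graph without short cycles that has an Eulerian circuit, and replace each vertex
-- by a gadget with 10 vertices: two pentagons joined by a bridge.  The edges of cost 1 are those of
-- the gadgets and one cross edge for each edge of the graph.  The Eulerian circuit, which passes
-- through both pentagons of every gadget, yields a Hamiltonian cycle of cost-1 edges.  On the other
-- hand each gadget has a Hamiltonian path; joining M of these paths by edges of cost 2 gives a tour
-- of length 11 M on 10 M vertices.
--
-- No 2-matching of cost-1 edges with few cross edges has fewer than M components.  A gadget with a
-- used cross edge falls apart into at least two pieces, since no Hamiltonian path of it starts at an
-- end of a cross edge.  As few edges of the graph form a forest, the touched gadgets can be added
-- leaf by leaf, each contributing one piece that stays separate; the root contributes even two.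
--
-- The graph arises from a figure eight by repeated coverings.  If κ is a labelling of the covering
-- graph that changes exactly along the edges above a given edge, then a cycle cannot pass just once
-- above this edge.  Cyclic coverings provide such labellings for all edges, and the order of the
-- fibre can be chosen such that the Eulerian circuit lifts to a single one.
module Submission where

open import Defs
open import Data.Bool using (Bool; true; false; _∧_; _∨_; not; if_then_else_) renaming (T to IsTrue)
open import Data.Bool.Properties using (∧-comm; not-involutive) renaming (_≟_ to _≟ᵇ_)
open import Data.Empty using (⊥)
open import Data.Fin using (Fin; zero; suc; toℕ; fromℕ; inject₁; _≟_)
open import Data.Fin.Induction using (<-weakInduction; >-weakInduction)
open import Data.Fin.Patterns using (0F; 1F; 2F; 3F; 4F)
import Data.Fin.Properties as Finₚ
open import Data.Fin.Relation.Unary.Top using (view; view-fromℕ; view-inject₁; ‵fromℕ; ‵inject₁)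
import Data.Integer as ℤ
import Data.Integer.Properties as ℤₚ
open import Data.List using (List; []; _∷_; _++_; length; map; filter; cartesianProduct)
import Data.List as List
open import Data.List.Membership.Propositional using (_∈_)
open import Data.List.Membership.Propositional.Properties
  using (∈-map⁺; ∈-map⁻; ∈-filter⁺; ∈-filter⁻; ∈-++⁺ˡ; ∈-++⁺ʳ; ∈-cartesianProduct⁺; ∈-allFin)
open import Data.List.Properties using (length-map; length-filter; filter-notAll; length-tabulate; length-++)
import Data.List.Relation.Unary.Any as Any
open Any using (here; there; any?)
open import Data.Maybe using (Maybe; just; nothing)
open import Data.Maybe.Properties using (just-injective)
import Data.Maybe.Properties as Maybeₚ
import Data.Nat as ℕ
open import Data.Nat using (ℕ; zero; suc; _+_; _*_; _≤_; _≡ᵇ_; _≤ᵇ_; _<ᵇ_; z≤n; s≤s)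
open import Data.Nat.GeneralisedArithmetic using (fold; fold-+)
import Data.Nat.Properties as ℕₚ
open import Data.Nat.Solver using (module +-*-Solver)
open import Data.Product using (Σ; _×_; _,_; proj₁; proj₂; ∃)
open import Data.Product.Function.NonDependent.Propositional using (_×-↔_)
open import Data.Product.Properties using (≡-dec)
import Data.Rational as ℚ
open import Data.Rational using (ℚ; 0ℚ; _<_)
import Data.Rational.Properties as ℚₚ
import Data.Rational.Unnormalised as ℚᵘ
import Data.Rational.Unnormalised.Properties as ℚᵘₚ
open import Data.Sum using (_⊎_; inj₁; inj₂; [_,_]′)
open import Data.Unit using (⊤; tt)
open import Function using (_∘_; _↔_; Inverse)
open import Function.Properties.Inverse using (↔-trans; ↔-sym; ↔-refl; Inverse⇒Injection)
open import Relation.Binary.Construct.Closure.ReflexiveTransitive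
  using (Star; _◅_; _◅◅_; reverse) renaming (ε to stop)
open import Relation.Binary.Definitions using (DecidableEquality)
open import Relation.Binary.PropositionalEquality
  using (_≡_; _≢_; refl; sym; trans; cong; cong₂; subst; subst₂; ≢-sym; module ≡-Reasoning)
open import Relation.Nullary using (¬_; Dec; yes; no; does)
open import Relation.Nullary.Decidable using (via-injection; map′; _⊎-dec_; ¬?)
open import Relation.Nullary.Negation using (contradiction)

-- Cyclic rotation of a finite set, and orbits of iterated maps

rot : ∀ {n} → Fin (suc n) → Fin (suc n)
rot i with view i
... | ‵fromℕ     = zero
... | ‵inject₁ j = suc j

rot⁻ : ∀ {n} → Fin (suc n) → Fin (suc n)
rot⁻ zero    = fromℕ _
rot⁻ (suc i) = inject₁ i

rot-fromℕ : ∀ n → rot (fromℕ n) ≡ zero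
rot-fromℕ n rewrite view-fromℕ n = refl

rot-inject₁ : ∀ {n} (i : Fin n) → rot (inject₁ i) ≡ suc i
rot-inject₁ i rewrite view-inject₁ i = refl

rot-rot⁻ : ∀ {n} (i : Fin (suc n)) → rot (rot⁻ i) ≡ i
rot-rot⁻ zero    = rot-fromℕ _
rot-rot⁻ (suc i) = rot-inject₁ i

rot⁻-rot : ∀ {n} (i : Fin (suc n)) → rot⁻ (rot i) ≡ i
rot⁻-rot i with view i
... | ‵fromℕ     = refl
... | ‵inject₁ _ = refl

-- A fibre needs at least two points for the rotation to move them all. This makes the fibre
-- coordinate a labelling that changes along every shifted edge.
rot-≢ : ∀ {n} (i : Fin (suc (suc n))) → rot i ≢ i
rot-≢ i with view i
... | ‵fromℕ     = λ ()
... | ‵inject₁ j = λ e → ℕₚ.1+n≢n (trans (cong toℕ e) (Finₚ.toℕ-inject₁ j))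

module _ {A : Set} (f : A → A) where

  Orbit : A → A → Set
  Orbit x y = ∃ λ i → fold x f i ≡ y

  orbit-trans : ∀ {x y z} → Orbit x y → Orbit y z → Orbit x z
  orbit-trans {x} (i , refl) (j , refl) = j + i , fold-+ x f j

  fold-return : ∀ {x} n → fold x f n ≡ x → ∀ t → fold x f (t * n) ≡ x
  fold-return n e zero = refl
  fold-return {x} n e (suc t) =
    trans (fold-+ x f n) (trans (cong (λ y → fold y f n) (fold-return n e t)) e)

  fold-comm : ∀ x i j → fold (fold x f i) f j ≡ fold (fold x f j) f i
  fold-comm x i j =
    trans (sym (fold-+ x f j)) (trans (cong (fold x f) (ℕₚ.+-comm j i)) (fold-+ x f i))

  fold-cancel : ∀ {g : A → A} → (∀ x → f (g x) ≡ x) → ∀ x i → fold (fold x g i) f i ≡ x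
  fold-cancel {g} fg x zero    = refl
  fold-cancel {g} fg x (suc i) =
    trans (fold-comm (g (fold x g i)) i 1)
      (trans (cong (λ y → fold y f i) (fg (fold x g i))) (fold-cancel {g} fg x i))

rot-orbit : ∀ {n} (i : Fin (suc n)) → fold zero rot (toℕ i) ≡ i
rot-orbit = <-weakInduction (λ i → fold zero rot (toℕ i) ≡ i) refl λ i ih →
  trans (cong rot (trans (cong (fold zero rot) (sym (Finₚ.toℕ-inject₁ i))) ih)) (rot-inject₁ i)

rot-period : ∀ {n} (i : Fin (suc n)) → fold i rot (suc n) ≡ i
rot-period {n} i = begin
  fold i rot (suc n)                        ≡⟨ cong (λ x → fold x rot (suc n)) (sym (rot-orbit i)) ⟩
  fold (fold zero rot (toℕ i)) rot (suc n)  ≡⟨ fold-comm rot zero (toℕ i) (suc n) ⟩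
  fold (fold zero rot (suc n)) rot (toℕ i)  ≡⟨ cong (λ x → fold x rot (toℕ i)) back ⟩
  fold zero rot (toℕ i)                     ≡⟨ rot-orbit i ⟩
  i ∎
  where
  open ≡-Reasoning
  back : fold zero rot (suc n) ≡ zero
  back = trans (cong rot (trans (cong (fold zero rot) (sym (Finₚ.toℕ-fromℕ n))) (rot-orbit (fromℕ n))))
           (rot-fromℕ n)

-- A full turn has `suc n` steps, so stopping one step early is a step back. Since `n` is coprime to
-- `suc n`, `n` shifts generate the whole rotation group of the fibre.
fold-rot-last : ∀ {n} (i : Fin (suc n)) → fold i rot n ≡ rot⁻ i
fold-rot-last {n} i = trans (sym (rot⁻-rot _)) (cong rot⁻ (rot-period i))

-- Eulerian circuits of 4-regular multigraphs

-- Every vertex is visited twice, at the positions (v , false) and (v , true);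
-- the position p also names the edge from proj₁ p to proj₁ (next p).
record Circuit : Set₁ where
  field
    V         : Set
    size⁻     : ℕ
    finite    : V ↔ Fin (suc size⁻)
    next prev : V × Bool → V × Bool
    next-prev : ∀ p → next (prev p) ≡ p
    prev-next : ∀ p → prev (next p) ≡ p
    root      : V × Bool
    single    : ∀ p → Orbit next root p

  abstract
    _≟ᵛ_ : DecidableEquality V
    _≟ᵛ_ = via-injection (Inverse⇒Injection finite) Finₚ._≟_

    _≟ᵖ_ : DecidableEquality (V × Bool)
    _≟ᵖ_ = ≡-dec _≟ᵛ_ _≟ᵇ_

  next-injective : ∀ {p q} → next p ≡ next q → p ≡ q
  next-injective {p} {q} e = trans (sym (prev-next p)) (trans (cong prev e) (prev-next q))

  tail head : V × Bool → V
  tail p = proj₁ p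
  head p = proj₁ (next p)

  Incident : V × Bool → V → Set
  Incident p v = tail p ≡ v ⊎ head p ≡ v

  -- A loop is a single position too, but has both its ends at its vertex; the last condition
  -- excludes it.
  Leaf : List (V × Bool) → V → Set
  Leaf S y = Σ (V × Bool) λ q →
    q ∈ S × Incident q y × (∀ {q'} → q' ∈ S → Incident q' y → q' ≡ q) × tail q ≢ head q

module Coverings where
  open Circuit

  -- The edge sets with at most K edges are forests: each has a leaf, and even two.
  Forests : ℕ → Circuit → Set
  Forests K H = ∀ S → length S ≤ K → ∀ {q} → q ∈ S → ∀ x → Σ (V H) λ y → y ≢ x × Leaf H S y

  -- Coverings

  -- A position keeps its visit `s`, so the map of the vertices determines everything. The function
  -- `lift` goes downwards, from positions of `H'` to those of `H`. By `π-root`, the circuit from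
  -- the root upstairs projects to the one from the root downstairs.
  record Cover (H' H : Circuit) : Set where
    field
      π : V H' → V H
    lift : V H' × Bool → V H × Bool
    lift (v , s) = π v , s
    field
      π-next : ∀ p → lift (next H' p) ≡ next H (lift p)
      π-root : lift (root H') ≡ root H

  open Cover

  module _ {H' H : Circuit} (c : Cover H' H) where

    Incident-lift : ∀ {q y} → Incident H' q y → Incident H (lift c q) (π c y)
    Incident-lift {q} (inj₁ e) = inj₁ (cong (π c) e)
    Incident-lift {q} (inj₂ e) = inj₂ (trans (cong proj₁ (sym (π-next c q))) (cong (π c) e))

    tail-unique : ∀ {q q'} → lift c q ≡ lift c q' → tail H' q ≡ tail H' q' → q ≡ q'
    tail-unique e t = cong₂ _,_ t (cong proj₂ e)

    head-unique : ∀ {q q'} → lift c q ≡ lift c q' → head H' q ≡ head H' q' → q ≡ q'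
    head-unique {q} {q'} e t = next-injective H' (tail-unique
      (trans (π-next c q) (trans (cong (next H) e) (sym (π-next c q')))) t)

    head-lift : ∀ q → π c (head H' q) ≡ head H (lift c q)
    head-lift q = cong proj₁ (π-next c q)

    -- Coverings are injective near a vertex: a vertex is the tail of only one edge above a given
    -- one, and likewise the head of only one. It could be the tail of one and the head of another
    -- only above a loop.
    Incident-unique : ∀ {q q' y} → tail H (lift c q) ≢ head H (lift c q) → lift c q' ≡ lift c q →
      Incident H' q y → Incident H' q' y → q' ≡ q
    Incident-unique nl e (inj₁ a) (inj₁ b) = tail-unique e (trans b (sym a))
    Incident-unique nl e (inj₂ a) (inj₂ b) = head-unique e (trans b (sym a))
    Incident-unique {q} {q'} nl e (inj₁ a) (inj₂ b) = contradiction
      (trans (cong (π c) (trans a (sym b))) (trans (head-lift q') (cong (head H) e))) nl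
    Incident-unique {q} {q'} nl e (inj₂ a) (inj₁ b) = contradiction
      (trans (sym (cong proj₁ e)) (trans (cong (π c) (trans b (sym a))) (head-lift q))) nl

    -- Any edge of `S` at the lifted end projects to an edge at `y`, hence to the only one there,
    -- and `Incident-unique` identifies it upstairs.
    Leaf-lift : ∀ {S y} → Leaf H (map (lift c) S) y → Σ (V H') λ y' → π c y' ≡ y × Leaf H' S y'
    Leaf-lift {S} {y} (q , q∈ , inc , unique , nl) with ∈-map⁻ (lift c) q∈
    ... | q̃ , q̃∈ , refl = ỹ , πỹ≡y , q̃ , q̃∈ , inc' , unique' , λ e → nl (trans (cong (π c) e) (head-lift q̃))
      where
      end : Incident H (lift c q̃) y → Σ (V H') λ y' → π c y' ≡ y × Incident H' q̃ y'
      end (inj₁ e) = tail H' q̃ , e , inj₁ refl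
      end (inj₂ e) = head H' q̃ , trans (head-lift q̃) e , inj₂ refl
      ỹ = proj₁ (end inc)
      πỹ≡y = proj₁ (proj₂ (end inc))
      inc' = proj₂ (proj₂ (end inc))
      unique' : ∀ {q'} → q' ∈ S → Incident H' q' ỹ → q' ≡ q̃
      unique' {q'} q'∈ i = Incident-unique nl
        (unique (∈-map⁺ (lift c) q'∈) (subst (Incident H (lift c q')) πỹ≡y (Incident-lift i))) inc' i

    -- The list `T` has the same elements as the image of `S` but may be shorter. Thus edges of `S`
    -- with a common image count only once against the bound `K`.
    Forests-lift : ∀ {K} → Forests K H → ∀ S {T} → length T ≤ K → (∀ {q} → q ∈ map (lift c) S → q ∈ T) →
      (∀ {q} → q ∈ T → q ∈ map (lift c) S) → ∀ {q} → q ∈ S → ∀ x → Σ (V H') λ y → y ≢ x × Leaf H' S y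
    Forests-lift forests S {T} short S⊆T T⊆S q∈ x
      with forests T short (S⊆T (∈-map⁺ (lift c) q∈)) (π c x)
    ... | y , y≢ , r , r∈ , inc , unique , nl
      with Leaf-lift (r , T⊆S r∈ , inc , (λ m → unique (S⊆T m)) , nl)
    ... | y' , refl , leaf = y' , (λ e → y≢ (cong (π c) e)) , leaf

    record Separated (p : V H × Bool) : Set₁ where
      field
        Label : Set
        _≟ˡ_  : DecidableEquality Label
        κ     : V H' → Label
        κ-≡   : ∀ q → lift c q ≢ p → κ (tail H' q) ≡ κ (head H' q)
        κ-≢   : ∀ q → lift c q ≡ p → κ (tail H' q) ≢ κ (head H' q)

    -- If only one edge of S lies above p then deleting it separates its two ends, and the
    -- side not containing x has a leaf by Forests K.
    Forests-suc : ∀ {K} → Forests K H → (∀ p → Separated p) → Forests (suc K) H'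
    Forests-suc {K} forests sep (e ∷ S) (s≤s short) _ x with any? (_≟ᵖ_ H (lift c e)) (map (lift c) S)
    -- The images of `S` include that of `e`, so at most `K` edges downstairs are involved although
    -- `e ∷ S` may have one more.
    ... | yes above = Forests-lift forests (e ∷ S) {map (lift c) S}
            (subst (_≤ K) (sym (length-map (lift c) S)) short)
            (λ { (here refl) → above ; (there m) → m }) there (here refl) x
    ... | no ¬above = choose
      where
      open Separated (sep (lift c e))
      κ-const : ∀ {q v} → q ∈ S → Incident H' q v → κ (tail H' q) ≡ κ v
      κ-const q∈ (inj₁ i) = cong κ i
      κ-const {q} q∈ (inj₂ i) =
        trans (κ-≡ q λ eq → ¬above (subst (_∈ map (lift c) S) eq (∈-map⁺ (lift c) q∈))) (cong κ i)
      side : ∀ {a b} → κ a ≢ κ x → κ a ≢ κ b → Incident H' e a →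
        (∀ {v} → Incident H' e v → v ≡ a ⊎ v ≡ b) → Σ (V H') λ y → y ≢ x × Leaf H' (e ∷ S) y
      side {a} {b} a≢x a≢b inc ends = result S₀ refl
        where
        onSide? = λ q → κ (tail H' q) ≟ˡ κ a
        S₀ = filter onSide? S
        nonloop : tail H' e ≢ head H' e
        nonloop eq = κ-≢ e refl (cong κ eq)
        -- If no edge of `S` is on the side of `a`, then `a` itself is a leaf with edge `e`.
        -- Otherwise the edges on this side have a leaf other than `a`, which `e` misses since its
        -- other end `b` carries a different label.
        result : ∀ R → R ≡ S₀ → Σ (V H') λ y → y ≢ x × Leaf H' (e ∷ S) y
        result [] eq = a , (λ a≡x → a≢x (cong κ a≡x)) , e , here refl , inc , only , nonloop
          where
          only : ∀ {q} → q ∈ e ∷ S → Incident H' q a → q ≡ e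
          only (here q≡e) i = q≡e
          only {q} (there q∈) i with subst (q ∈_) (sym eq) (∈-filter⁺ onSide? q∈ (κ-const q∈ i))
          ... | ()
        result (r ∷ _) eq with Forests-lift forests S₀ {map (lift c) S₀}
            (subst (_≤ K) (sym (length-map (lift c) S₀)) (ℕₚ.≤-trans (length-filter onSide? S) short))
            (λ m → m) (λ m → m) (subst (r ∈_) eq (here refl)) a
        ... | y , y≢a , q , q∈₀ , i , unique , nl =
          y , (λ y≡x → a≢x (trans (sym κy) (cong κ y≡x))) , q , there q∈ , i , only , nl
          where
          q∈ = proj₁ (∈-filter⁻ onSide? {xs = S} q∈₀)
          κy : κ y ≡ κ a
          κy = trans (sym (κ-const q∈ i)) (proj₂ (∈-filter⁻ onSide? {xs = S} q∈₀))
          only : ∀ {r} → r ∈ e ∷ S → Incident H' r y → r ≡ q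
          only (there r∈) j = unique (∈-filter⁺ onSide? r∈ (trans (κ-const r∈ j) κy)) j
          only (here refl) j with ends j
          ... | inj₁ y≡a = contradiction y≡a y≢a
          ... | inj₂ y≡b = contradiction (trans (sym κy) (cong κ y≡b)) a≢b
      choose : Σ (V H') λ y → y ≢ x × Leaf H' (e ∷ S) y
      -- The labels of the two ends of `e` differ, so one of them is not the label of `x`.
      choose with κ (tail H' e) ≟ˡ κ x
      ... | no ne = side ne (κ-≢ e refl) (inj₁ refl) λ { (inj₁ i) → inj₁ (sym i) ; (inj₂ i) → inj₂ (sym i) }
      ... | yes eq = side (λ eq' → κ-≢ e refl (trans eq (sym eq'))) (≢-sym (κ-≢ e refl)) (inj₂ refl)
                       λ { (inj₁ i) → inj₂ (sym i) ; (inj₂ i) → inj₁ (sym i) }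

  open Separated

  id-cover : ∀ {H} → Cover H H
  id-cover = record { π = λ v → v ; π-next = λ _ → refl ; π-root = refl }

  ∘-cover : ∀ {H'' H' H} → Cover H'' H' → Cover H' H → Cover H'' H
  ∘-cover d c = record
    { π = λ v → π c (π d v)
    ; π-next = λ p → trans (cong (lift c) (π-next d p)) (π-next c (lift d p))
    ; π-root = trans (cong (lift c) (π-root d)) (π-root c)
    }

  -- Labels are pulled back along `d`. Hence the edges of `H` can be treated one after another, and
  -- a further covering keeps what was achieved.
  ∘-separated : ∀ {H'' H' H} (d : Cover H'' H') (c : Cover H' H) {p} → Separated c p → Separated (∘-cover d c) p
  ∘-separated d c s = record
    { Label = Label s
    ; _≟ˡ_ = _≟ˡ_ s
    ; κ = λ v → κ s (π d v)
    ; κ-≡ = λ q ne → trans (κ-≡ s (lift d q) ne) (cong (κ s) (sym (head-lift d q)))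
    ; κ-≢ = λ q eq e → κ-≢ s (lift d q) eq (trans e (cong (κ s) (head-lift d q)))
    }

  -- The cyclic cover in which the edges of D shift the fibre by one.  Here c is the number of
  -- edges of D on a closed walk (a number of laps of the circuit), so that these laps act on the
  -- c + 1 points of the fibre as a single cycle.
  module Cyclic (H : Circuit) (D : V H × Bool → Bool) where

    shifts : ℕ → ℕ
    shifts zero    = 0
    shifts (suc i) = (if D (fold (root H) (next H) i) then 1 else 0) + shifts i

    shifts-pos : ∀ {i} n → i ℕ.< n → D (fold (root H) (next H) i) ≡ true → 0 ℕ.< shifts n
    shifts-pos {i} (suc n) (s≤s i≤n) d with ℕₚ.m≤n⇒m<n∨m≡n i≤n
    ... | inj₁ i<n = ℕₚ.≤-trans (shifts-pos n i<n d) (ℕₚ.m≤n+m _ _)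
    ... | inj₂ refl rewrite d = s≤s z≤n

    module Fibre (c : ℕ) where

      V' : Set
      V' = V H × Fin (suc c)

      shift shift⁻ : Bool → Fin (suc c) → Fin (suc c)
      shift  b g = if b then rot g else g
      shift⁻ b g = if b then rot⁻ g else g

      shift-shift⁻ : ∀ b g → shift b (shift⁻ b g) ≡ g
      shift-shift⁻ true  g = rot-rot⁻ g
      shift-shift⁻ false g = refl

      shift⁻-shift : ∀ b g → shift⁻ b (shift b g) ≡ g
      shift⁻-shift true  g = rot⁻-rot g
      shift⁻-shift false g = refl

      next' prev' : V' × Bool → V' × Bool
      next' ((v , g) , s) = (proj₁ (next H (v , s)) , shift (D (v , s)) g) , proj₂ (next H (v , s))
      prev' ((v , g) , s) = (proj₁ (prev H (v , s)) , shift⁻ (D (prev H (v , s))) g) , proj₂ (prev H (v , s))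

      at : V H × Bool → Fin (suc c) → V' × Bool
      at (v , s) g = (v , g) , s

      next'-prev' : ∀ p → next' (prev' p) ≡ p
      next'-prev' ((v , g) , s) = cong₂ at (next-prev H (v , s)) (shift-shift⁻ (D (prev H (v , s))) g)

      prev'-next' : ∀ p → prev' (next' p) ≡ p
      prev'-next' ((v , g) , s) = cong₂ at (prev-next H (v , s))
        (trans (cong (λ q → shift⁻ (D q) (shift (D (v , s)) g)) (prev-next H (v , s))) (shift⁻-shift (D (v , s)) g))

      shift-rot : ∀ b g → shift b g ≡ fold g rot (if b then 1 else 0)
      shift-rot true  g = refl
      shift-rot false g = refl

      walk : ∀ g i → fold (at (root H) g) next' i ≡ at (fold (root H) (next H) i) (fold g rot (shifts i))
      walk g zero    = refl
      walk g (suc i) = trans (cong next' (walk g i))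
        (cong (at (next H q)) (trans (shift-rot (D q) _)
          (sym (fold-+ g rot (if D q then 1 else 0)))))
        where q = fold (root H) (next H) i

      module _ (lap : ℕ) (closed : fold (root H) (next H) lap ≡ root H) (c≡ : shifts lap ≡ c) where

        -- One closed walk shifts the fibre `c` times, which by `fold-rot-last` is one step back.
        -- Starting from zero, which goes to the top point, repeated walks descend through the whole
        -- fibre.
        orbit-root : ∀ g → Orbit next' (at (root H) zero) (at (root H) g)
        orbit-root = >-weakInduction _ (orbit-lap (0 , refl)) (λ i → orbit-lap)
          where
          orbit-lap : ∀ {g} → Orbit next' (at (root H) zero) (at (root H) g) →
            Orbit next' (at (root H) zero) (at (root H) (rot⁻ g))
          orbit-lap {g} o = orbit-trans next' o (lap , trans (walk g lap)
            (cong₂ at closed (trans (cong (fold g rot) c≡) (fold-rot-last g))))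

        single' : ∀ p → Orbit next' (at (root H) zero) p
        single' ((v , g) , s) with single H (v , s)
        -- The starting point in the fibre is `g` moved back by the shifts still to come, so the
        -- walk arrives at `g`.
        ... | i , e = orbit-trans next' (orbit-root (fold g rot⁻ (shifts i)))
          (i , trans (walk _ i) (cong₂ at e (fold-cancel rot rot-rot⁻ g (shifts i))))

        circuit : Circuit
        circuit = record
          -- The successor of this number computes to `suc (size⁻ H) * suc c`.
          { V = V' ; size⁻ = c + size⁻ H * suc c
          ; finite = ↔-trans (finite H ×-↔ ↔-refl) (↔-sym (Finₚ.*↔× {suc (size⁻ H)} {suc c}))
          ; next = next' ; prev = prev' ; next-prev = next'-prev' ; prev-next = prev'-next'
          ; root = at (root H) zero ; single = single'
          }

        cover : Cover circuit H
        cover = record { π = proj₁ ; π-next = λ _ → refl ; π-root = refl }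

  -- The edges of `H'` above `p` are exactly those that shift the fibre, so the fibre coordinate of
  -- the resulting cyclic cover is the labelling sought.
  separate : ∀ {H' H} (c : Cover H' H) p → Σ Circuit λ H'' → Σ (Cover H'' H') λ d → Separated (∘-cover d c) p
  separate {H'} {H} c p with single H p | single H' (prev H' (root H'))
  ... | i , reach | l , back = result (shifts lap) refl (shifts-pos lap i<lap Dᵢ)
    where
    D : V H' × Bool → Bool
    D q = does (_≟ᵖ_ H (lift c q) p)
    open Cyclic H' D
    -- Every `suc l` steps the circuit of `H'` returns to its root. Repeating this `suc i` times
    -- gives a closed walk longer than `i` steps; after `i` steps it is above `p`, so at least one
    -- shift occurs.
    lap : ℕ
    lap = suc i * suc l
    i<lap : i ℕ.< lap
    i<lap = ℕₚ.m≤m*n (suc i) (suc l)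
    closed : fold (root H') (next H') lap ≡ root H'
    closed = fold-return (next H') (suc l) (trans (cong (next H') back) (next-prev H' (root H'))) (suc i)
    fold-lift : ∀ j → lift c (fold (root H') (next H') j) ≡ fold (root H) (next H) j
    fold-lift zero    = π-root c
    fold-lift (suc j) = trans (π-next c _) (cong (next H) (fold-lift j))
    Dᵢ : D (fold (root H') (next H') i) ≡ true
    Dᵢ with _≟ᵖ_ H (lift c (fold (root H') (next H') i)) p
    ... | yes _ = refl
    ... | no ne = contradiction (trans (fold-lift i) reach) ne
    result : ∀ s → shifts lap ≡ s → 0 ℕ.< s → Σ Circuit λ H'' → Σ (Cover H'' H') λ d → Separated (∘-cover d c) p
    result (suc s) eq _ = circuit lap closed eq , cover lap closed eq , record
      { Label = Fin (suc (suc s)) ; _≟ˡ_ = Finₚ._≟_ ; κ = proj₂ ; κ-≡ = fixes ; κ-≢ = moves }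
      where
      open Fibre (suc s)
      fixes : ∀ (q : V' × Bool) → lift c (proj₁ (proj₁ q) , proj₂ q) ≢ p → proj₂ (proj₁ q) ≡ proj₂ (proj₁ (next' q))
      fixes ((v , g) , t) ne with _≟ᵖ_ H (lift c (v , t)) p
      ... | yes e = contradiction e ne
      ... | no _ = refl
      moves : ∀ (q : V' × Bool) → lift c (proj₁ (proj₁ q) , proj₂ q) ≡ p → proj₂ (proj₁ q) ≢ proj₂ (proj₁ (next' q))
      moves ((v , g) , t) e with _≟ᵖ_ H (lift c (v , t)) p
      ... | yes _ = ≢-sym (rot-≢ g)
      ... | no ne = contradiction e ne

  separate-all : ∀ H (l : List (V H × Bool)) → Σ Circuit λ H' → Σ (Cover H' H) λ c → ∀ {p} → p ∈ l → Separated c p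
  separate-all H []      = H , id-cover , λ ()
  separate-all H (p ∷ l) with separate-all H l
  ... | H' , c , sep with separate c p
  ... | H'' , d , sepₚ = H'' , ∘-cover d c , λ { (here refl) → sepₚ ; (there m) → ∘-separated d c (sep m) }

  positions : ∀ H → List (V H × Bool)
  positions H = cartesianProduct (map (Inverse.from (finite H)) (List.allFin (suc (size⁻ H)))) (true ∷ false ∷ [])

  ∈-positions : ∀ H p → p ∈ positions H
  ∈-positions H (v , s) = ∈-cartesianProduct⁺
    (subst (_∈ vertices) (Inverse.strictlyInverseʳ (finite H) v)
      (∈-map⁺ (Inverse.from (finite H)) (∈-allFin (Inverse.to (finite H) v)))) (bool s)
    where
    vertices = map (Inverse.from (finite H)) (List.allFin (suc (size⁻ H)))
    bool : ∀ s → s ∈ true ∷ false ∷ []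
    bool true  = here refl
    bool false = there (here refl)

  figure-eight : Circuit
  figure-eight = record
    { V = ⊤ ; size⁻ = 0 ; finite = ↔-sym Finₚ.1↔⊤
    ; next = flip' ; prev = flip' ; next-prev = flip'-flip' ; prev-next = flip'-flip'
    ; root = tt , false
    ; single = λ { (tt , false) → 0 , refl ; (tt , true) → 1 , refl }
    }
    where
    flip' : ⊤ × Bool → ⊤ × Bool
    flip' (v , s) = v , not s
    flip'-flip' : ∀ p → flip' (flip' p) ≡ p
    flip'-flip' (v , s) = cong (v ,_) (not-involutive s)

  raise-girth : ∀ {K} H → Forests K H → Σ Circuit (Forests (suc K))
  raise-girth H forests = proj₁ cover-of-H , Forests-suc (proj₁ (proj₂ cover-of-H)) forests
    λ p → proj₂ (proj₂ cover-of-H) (∈-positions H p)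
    where cover-of-H = separate-all H (positions H)

  high-girth : ∀ K → Σ Circuit (Forests K)
  -- A list of length zero contains no edge, so even a graph with two loops qualifies.
  high-girth zero    = figure-eight , λ { [] _ () ; (_ ∷ _) () }
  high-girth (suc K) = raise-girth (proj₁ (high-girth K)) (proj₂ (high-girth K))

open Coverings using (Forests; high-girth)

-- Finite sums and counting

∧-true : ∀ {a b} → a ∧ b ≡ true → a ≡ true × b ≡ true
∧-true {true} {true} _ = refl , refl

∨-true : ∀ {a b} → a ∨ b ≡ true → a ≡ true ⊎ b ≡ true
∨-true {true}  _ = inj₁ refl
∨-true {false} e = inj₂ e

∨-trueʳ : ∀ a {b} → b ≡ true → a ∨ b ≡ true
∨-trueʳ true  _ = refl
∨-trueʳ false e = e

true≢false : ∀ {b} → b ≡ true → b ≢ false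
true≢false refl ()

not-true : ∀ {b} → not b ≡ true → b ≡ false
not-true {false} _ = refl

bool-≡ : ∀ {a b} → (a ≡ true → b ≡ true) → (b ≡ true → a ≡ true) → a ≡ b
bool-≡ {true}  f g = sym (f refl)
bool-≡ {false} {true}  f g = g refl
bool-≡ {false} {false} f g = refl

does-true : ∀ {P : Set} (d : Dec P) → P → does d ≡ true
does-true (yes _) _ = refl
does-true (no ¬p) p = contradiction p ¬p

does-sound : ∀ {P : Set} (d : Dec P) → does d ≡ true → P
does-sound (yes p) _ = p

sum-cong : ∀ {n} {f g : Fin n → ℕ} → (∀ i → f i ≡ g i) → sumFin f ≡ sumFin g
sum-cong {zero}  e = refl
sum-cong {suc n} e = cong₂ _+_ (e zero) (sum-cong (e ∘ suc))

sum-mono : ∀ {n} {f g : Fin n → ℕ} → (∀ i → f i ≤ g i) → sumFin f ≤ sumFin g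
sum-mono {zero}  e = z≤n
sum-mono {suc n} e = ℕₚ.+-mono-≤ (e zero) (sum-mono (e ∘ suc))

sum-const : ∀ n k → sumFin {n} (λ _ → k) ≡ n * k
sum-const zero    k = refl
sum-const (suc n) k = cong (k +_) (sum-const n k)

+-interchange : ∀ a b c d → (a + b) + (c + d) ≡ (a + c) + (b + d)
+-interchange = solve 4 (λ a b c d → (a :+ b) :+ (c :+ d) := (a :+ c) :+ (b :+ d)) refl
  where open +-*-Solver

sum-+ : ∀ {n} (f g : Fin n → ℕ) → sumFin (λ i → f i + g i) ≡ sumFin f + sumFin g
sum-+ {zero}  f g = refl
sum-+ {suc n} f g = trans (cong (f zero + g zero +_) (sum-+ (f ∘ suc) (g ∘ suc)))
  (+-interchange (f zero) (g zero) (sumFin (f ∘ suc)) (sumFin (g ∘ suc)))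

sum-swap : ∀ {m n} (f : Fin m → Fin n → ℕ) →
  sumFin (λ i → sumFin (f i)) ≡ sumFin (λ j → sumFin (λ i → f i j))
sum-swap {zero}  {n} f = sym (trans (sum-const n 0) (ℕₚ.*-zeroʳ n))
sum-swap {suc m} f = trans (cong (sumFin (f zero) +_) (sum-swap (f ∘ suc)))
  (sym (sum-+ (f zero) (λ j → sumFin (λ i → f (suc i) j))))

sum-≥-term : ∀ {n} (f : Fin n → ℕ) u → f u ≤ sumFin f
sum-≥-term f zero    = ℕₚ.m≤m+n _ _
sum-≥-term f (suc u) = ℕₚ.≤-trans (sum-≥-term (f ∘ suc) u) (ℕₚ.m≤n+m _ _)

del : ∀ {n} → (Fin n → Bool) → Fin n → Fin n → Bool
del p v u = if does (u ≟ v) then false else p u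

del-true : ∀ {n} {p : Fin n → Bool} {u v} → p u ≡ true → u ≢ v → del p v u ≡ true
del-true {u = u} {v} e ne with u ≟ v
... | yes eq = contradiction eq ne
... | no _   = e

del-sound : ∀ {n} {p : Fin n → Bool} {u v} → del p v u ≡ true → p u ≡ true × u ≢ v
del-sound {u = u} {v} e with u ≟ v
... | no ne = e , ne

count-del : ∀ {n} (p : Fin n → Bool) v → p v ≡ true → countFin p ≡ suc (countFin (del p v))
count-del p zero    e rewrite e = refl
count-del p (suc v) e =
  trans (cong ((if p zero then 1 else 0) +_) (count-del (p ∘ suc) v e)) (ℕₚ.+-suc _ _)

count-none : ∀ {n} {p : Fin n → Bool} → (∀ v → p v ≡ false) → countFin p ≡ 0
count-none {zero}  e = refl
count-none {suc n} e rewrite e zero = count-none (e ∘ suc)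

count-≤-length : ∀ {n} {p : Fin n → Bool} xs → (∀ {v} → p v ≡ true → v ∈ xs) → countFin p ≤ length xs
count-≤-length {p = p} [] covers = ℕₚ.≤-reflexive (count-none none)
  where
  none : ∀ v → p v ≡ false
  none v with p v in e
  ... | false = refl
  ... | true with covers e
  ... | ()
count-≤-length {p = p} (x ∷ xs) covers with p x in e
... | true = subst (_≤ suc (length xs)) (sym (count-del p x e)) (s≤s (count-≤-length xs rest))
  where
  rest : ∀ {v} → del p x v ≡ true → v ∈ xs
  rest {v} d with del-sound {p = p} {v} d
  ... | pv , ne with covers pv
  ... | here eq = contradiction eq ne
  ... | there m = m
... | false = ℕₚ.m≤n⇒m≤1+n (count-≤-length xs rest)
  where
  rest : ∀ {v} → p v ≡ true → v ∈ xs
  rest pv with covers pv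
  ... | here refl = contradiction e (true≢false pv)
  ... | there m   = m

count-≥-injection : ∀ {m n} {p : Fin n → Bool} (r : Fin m → Fin n) → (∀ {i j} → r i ≡ r j → i ≡ j) →
  (∀ i → p (r i) ≡ true) → m ≤ countFin p
count-≥-injection {zero}  r inj e = z≤n
count-≥-injection {suc m} {p = p} r inj e = subst (suc m ≤_) (sym (count-del p (r zero) (e zero)))
  (s≤s (count-≥-injection (r ∘ suc) (λ eq → Finₚ.suc-injective (inj eq))
    (λ i → del-true {p = p} (e (suc i)) λ eq → Finₚ.0≢1+n (sym (inj eq)))))

count-≥1 : ∀ {n} {p : Fin n → Bool} a → p a ≡ true → 1 ≤ countFin p
count-≥1 {p = p} a pa = subst (1 ≤_) (sym (count-del p a pa)) (s≤s z≤n)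

count-≥2 : ∀ {n} {p : Fin n → Bool} {a b} → p a ≡ true → p b ≡ true → b ≢ a → 2 ≤ countFin p
count-≥2 {p = p} {a} {b} pa pb ne =
  subst (2 ≤_) (sym (count-del p a pa)) (s≤s (count-≥1 b (del-true {p = p} pb ne)))

count-≥3 : ∀ {n} {p : Fin n → Bool} {a b c} → p a ≡ true → p b ≡ true → p c ≡ true →
  b ≢ a → c ≢ a → c ≢ b → 3 ≤ countFin p
count-≥3 {p = p} {a} pa pb pc b≢a c≢a c≢b = subst (3 ≤_) (sym (count-del p a pa))
  (s≤s (count-≥2 (del-true {p = p} pb b≢a) (del-true {p = p} pc c≢a) c≢b))

count-mono : ∀ {n} {p q : Fin n → Bool} → (∀ v → p v ≡ true → q v ≡ true) → countFin p ≤ countFin q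
count-mono {p = p} {q} sub = sum-mono λ i → pointwise (p i) (q i) (sub i)
  where
  pointwise : ∀ a b → (a ≡ true → b ≡ true) → (if a then 1 else 0) ≤ (if b then 1 else 0)
  pointwise false b     _ = z≤n
  pointwise true  true  _ = s≤s z≤n
  pointwise true  false f with f refl
  ... | ()

count-mono-< : ∀ {n} {p q : Fin n → Bool} v → (∀ v → p v ≡ true → q v ≡ true) →
  p v ≡ false → q v ≡ true → countFin p ℕ.< countFin q
count-mono-< {p = p} {q} v sub pv qv = subst (countFin p ℕ.<_) (sym (count-del q v qv))
  (s≤s (count-mono λ u pu → del-true {p = q} (sub u pu) λ { refl → true≢false pu pv }))

count-≤ : ∀ {n} (p : Fin n → Bool) → countFin p ≤ n
count-≤ {n} p = subst (countFin p ≤_) (trans (sum-const n 1) (ℕₚ.*-identityʳ n)) (sum-mono λ i → bit (p i))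
  where
  bit : ∀ b → (if b then 1 else 0) ≤ 1
  bit true  = s≤s z≤n
  bit false = z≤n

count-pos : ∀ {n} (p : Fin n → Bool) → 1 ≤ countFin p → ∃ λ v → p v ≡ true
count-pos {suc n} p e with p zero in eq
... | true  = zero , eq
... | false with count-pos (p ∘ suc) e
... | v , pv = suc v , pv

count-≤-sum : ∀ {n} (f : Fin n → ℕ) → countFin (λ u → 1 ≤ᵇ f u) ≤ sumFin f
count-≤-sum f = sum-mono λ u → pointwise (f u)
  where
  pointwise : ∀ m → (if 1 ≤ᵇ m then 1 else 0) ≤ m
  pointwise zero    = z≤n
  pointwise (suc m) = s≤s z≤n

trues : ∀ {n} → (Fin n → Bool) → List (Fin n)
trues {zero}  p = []
trues {suc n} p = if p zero then zero ∷ map suc (trues (p ∘ suc)) else map suc (trues (p ∘ suc))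

length-trues : ∀ {n} (p : Fin n → Bool) → length (trues p) ≡ countFin p
length-trues {zero}  p = refl
length-trues {suc n} p with p zero
... | true  = cong suc (trans (length-map suc (trues (p ∘ suc))) (length-trues (p ∘ suc)))
... | false = trans (length-map suc (trues (p ∘ suc))) (length-trues (p ∘ suc))

∈-trues : ∀ {n} (p : Fin n → Bool) {v} → p v ≡ true → v ∈ trues p
∈-trues {suc n} p {zero} e rewrite e = here refl
∈-trues {suc n} p {suc v} e with p zero
... | true  = there (∈-map⁺ suc (∈-trues (p ∘ suc) e))
... | false = ∈-map⁺ suc (∈-trues (p ∘ suc) e)

anyFin-true : ∀ {n} {p : Fin n → Bool} v → p v ≡ true → anyFin p ≡ true
anyFin-true zero e rewrite e = refl
anyFin-true {p = p} (suc v) e = ∨-trueʳ (p zero) (anyFin-true v e)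

anyFin-sound : ∀ {n} {p : Fin n → Bool} → anyFin p ≡ true → ∃ λ v → p v ≡ true
anyFin-sound {suc n} {p} e with ∨-true {p zero} e
... | inj₁ e₀ = zero , e₀
... | inj₂ e₁ with anyFin-sound e₁
... | v , pv = suc v , pv

allFin-true : ∀ {n} {p : Fin n → Bool} → (∀ v → p v ≡ true) → allFin p ≡ true
allFin-true {zero}  e = refl
allFin-true {suc n} e rewrite e zero = allFin-true (e ∘ suc)

allFin-sound : ∀ {n} {p : Fin n → Bool} → allFin p ≡ true → ∀ v → p v ≡ true
allFin-sound e zero    = proj₁ (∧-true e)
allFin-sound {p = p} e (suc v) = allFin-sound (proj₂ (∧-true {p zero} e)) v

module _ where
  open ≡-Reasoning
  open +-*-Solver

  -- Splitting off the vertex `zero` removes its row and its column, which agree by symmetry. The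
  -- weights let the identity serve both degrees and costs.
  handshake : ∀ {n} (c : Fin n → Fin n → ℕ) (A : Graph n) → IsSimple A → (∀ u v → c u v ≡ c v u) →
    sumFin (λ u → sumFin (λ v → if A u v then c u v else 0)) ≡ 2 * cost c A
  handshake {zero}  c A simple c-sym = refl
  handshake {suc n} c A (A-sym , A-irr) c-sym = begin
    (h zero zero + row) + sumFin (λ u → h (suc u) zero + sumFin (λ v → h (suc u) (suc v)))
      ≡⟨ cong₂ (λ a b → (a + row) + b) diagonal
           (sum-+ (λ u → h (suc u) zero) (λ u → sumFin (λ v → h (suc u) (suc v)))) ⟩
    row + (sumFin (λ u → h (suc u) zero) + sumFin (λ u → sumFin (λ v → h (suc u) (suc v))))
      ≡⟨ cong₂ (λ a b → row + (a + b)) (sum-cong flip-row)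
           (handshake (λ u v → c (suc u) (suc v)) (λ u v → A (suc u) (suc v))
             ((λ u v → A-sym (suc u) (suc v)) , λ u → A-irr (suc u)) (λ u v → c-sym (suc u) (suc v))) ⟩
    row + (row + 2 * rest)
      ≡⟨ solve 2 (λ a b → a :+ (a :+ con 2 :* b) := con 2 :* (a :+ b)) refl row rest ⟩
    2 * (row + rest) ∎
    where
    h : Fin (suc n) → Fin (suc n) → ℕ
    h u v = if A u v then c u v else 0
    row rest : ℕ
    row = sumFin (λ v → h zero (suc v))
    rest = cost (λ u v → c (suc u) (suc v)) (λ u v → A (suc u) (suc v))
    diagonal : h zero zero ≡ 0
    diagonal rewrite A-irr zero = refl
    flip-row : ∀ u → h (suc u) zero ≡ h zero (suc u)
    flip-row u = cong₂ (λ b m → if b then m else 0) (A-sym (suc u) zero) (c-sym (suc u) zero)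

  sum-deg : ∀ {n} (A : Graph n) → IsSimple A → sumFin (deg A) ≡ 2 * countPairs A
  sum-deg A simple = handshake (λ _ _ → 1) A simple (λ _ _ → refl)

bit-split : ∀ a b → (if a then 1 else 0) ≡ (if a ∧ b then 1 else 0) + (if a ∧ not b then 1 else 0)
bit-split false _     = refl
bit-split true  true  = refl
bit-split true  false = refl

count-split : ∀ {n} (p q : Fin n → Bool) →
  countFin p ≡ countFin (λ v → p v ∧ q v) + countFin (λ v → p v ∧ not (q v))
count-split {n} p q = trans (sum-cong λ v → bit-split (p v) (q v)) (sum-+ {n} _ _)

-- Walks and connected components

Path : ∀ {n} → Graph n → Fin n → Fin n → Set
Path A = Star (λ u v → A u v ≡ true)

module _ {n : ℕ} (A : Graph n) where

  reachB-sound : ∀ m {u v} → reachB A m u v ≡ true → Path A u v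
  reachB-sound zero {u} {v} e with u ≟ v
  ... | yes refl = stop
  reachB-sound (suc m) {u} {v} e with ∨-true {reachB A m u v} e
  ... | inj₁ e₁ = reachB-sound m e₁
  ... | inj₂ e₂ with anyFin-sound e₂
  ... | w , ew with ∧-true {reachB A m u w} ew
  ... | e₃ , e₄ = reachB-sound m e₃ ◅◅ (e₄ ◅ stop)

  reachB-refl : ∀ m u → reachB A m u u ≡ true
  reachB-refl zero u with u ≟ u
  ... | yes _ = refl
  ... | no ne = contradiction refl ne
  reachB-refl (suc m) u rewrite reachB-refl m u = refl

  reachB-suc : ∀ m {u v} → reachB A m u v ≡ true → reachB A (suc m) u v ≡ true
  reachB-suc m e rewrite e = refl

  reachB-step : ∀ m {u v w} → reachB A m u v ≡ true → A v w ≡ true → reachB A (suc m) u w ≡ true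
  reachB-step m {u} {v} {w} e₁ e₂ = ∨-trueʳ (reachB A m u w) (anyFin-true v both)
    where
    both : reachB A m u v ∧ A v w ≡ true
    both rewrite e₁ = e₂

  reachB-mono : ∀ {m m'} → m ≤ m' → ∀ {u v} → reachB A m u v ≡ true → reachB A m' u v ≡ true
  reachB-mono {m} {m'} le {u} {v} e with ℕₚ.m≤n⇒m<n∨m≡n le
  reachB-mono {m} {suc m'} le e | inj₁ (s≤s lt) = reachB-suc m' (reachB-mono lt e)
  reachB-mono {m} {m'} le e | inj₂ refl = e

  Closed : ℕ → Fin n → Set
  Closed m u = ∀ {v w} → reachB A m u v ≡ true → A v w ≡ true → reachB A m u w ≡ true

  -- Every step before the reachable set is closed makes it larger.
  closes : ∀ u m → (∃ λ j → j ≤ m × Closed j u) ⊎ m ℕ.< countFin (reachB A m u)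
  closes u zero = inj₂ (count-≥1 u (reachB-refl zero u))
  closes u (suc m) with closes u m
  ... | inj₁ (j , j≤m , closed) = inj₁ (j , ℕₚ.m≤n⇒m≤1+n j≤m , closed)
  ... | inj₂ large with anyFin (λ v → reachB A (suc m) u v ∧ not (reachB A m u v)) in eq
  ... | true = inj₂ (ℕₚ.<-≤-trans (s≤s large) (grow (anyFin-sound eq)))
    where
    grow : (∃ λ v → reachB A (suc m) u v ∧ not (reachB A m u v) ≡ true) →
      countFin (reachB A m u) ℕ.< countFin (reachB A (suc m) u)
    grow (v , e) with ∧-true {reachB A (suc m) u v} e
    ... | new , old = count-mono-< v (λ _ → reachB-suc m) (not-true old) new
  ... | false = inj₁ (m , ℕₚ.n≤1+n m , closed)
    where
    closed : Closed m u
    closed {v} {w} e₁ e₂ with reachB A m u w in eq'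
    ... | true = refl
    ... | false = contradiction eq (true≢false (anyFin-true w both))
      where
      both : reachB A (suc m) u w ∧ not (reachB A m u w) ≡ true
      both = cong₂ (λ a b → a ∧ not b) (reachB-step m e₁ e₂) eq'

  -- Growing at each of `n` steps would give a set of more than `n` vertices. So the reachable set
  -- is closed at some stage `j ≤ n`, and then contains the end of every walk from `u`.
  conn-complete : ∀ {u v} → Path A u v → conn A u v ≡ true
  conn-complete {u} p with closes u n
  ... | inj₂ large = contradiction (count-≤ (reachB A n u)) (ℕₚ.<⇒≱ large)
  ... | inj₁ (j , j≤n , closed) = reachB-mono j≤n (along (reachB-refl j u) p)
    where
    along : ∀ {v w} → reachB A j u v ≡ true → Path A v w → reachB A j u w ≡ true
    along e stop = e
    along e (s ◅ p) = along (closed e s) p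

  isRep-minimal : ∀ {v u} → isRep A v ≡ true → Path A u v → toℕ v ≤ toℕ u
  isRep-minimal {v} {u} rep p = bound
    (subst (λ b → not b ∨ (toℕ v ≤ᵇ toℕ u) ≡ true) (conn-complete p) (allFin-sound rep u))
    where
    bound : (toℕ v ≤ᵇ toℕ u) ≡ true → toℕ v ≤ toℕ u
    bound e = ℕₚ.≤ᵇ⇒≤ _ _ (subst IsTrue (sym e) _)

  -- The search moves to a smaller vertex that reaches the present one until there is none; `k`
  -- exceeds the number of the present vertex and bounds the steps.
  representative : ∀ u → ∃ λ r → isRep A r ≡ true × Path A r u
  representative u = search (suc (toℕ u)) u ℕₚ.≤-refl
    where
    search : ∀ k u → toℕ u ℕ.< k → ∃ λ r → isRep A r ≡ true × Path A r u
    search (suc k) u (s≤s le) with anyFin (λ w → conn A w u ∧ not (toℕ u ≤ᵇ toℕ w)) in eq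
    ... | true with anyFin-sound eq
    ... | w , e with ∧-true {conn A w u} e
    ... | e₁ , e₂ with search k w (ℕₚ.<-≤-trans (ℕₚ.≰⇒> λ le' → smaller e₂ (ℕₚ.≤⇒≤ᵇ le')) le)
      where
      smaller : ∀ {b} → not b ≡ true → ¬ IsTrue b
      smaller {false} _ ()
    ... | r , rep , p = r , rep , p ◅◅ reachB-sound n e₁
    search (suc k) u (s≤s le) | false = u , allFin-true minimal , stop
      where
      minimal : ∀ w → not (conn A w u) ∨ (toℕ u ≤ᵇ toℕ w) ≡ true
      minimal w with conn A w u in e₁ | toℕ u ≤ᵇ toℕ w in e₂
      ... | false | _    = refl
      ... | true  | true = refl
      ... | true  | false = contradiction eq (true≢false (anyFin-true w (cong₂ (λ a b → a ∧ not b) e₁ e₂)))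

  Invariant : {C : Set} → (Fin n → C) → Set
  Invariant col = ∀ {u v} → A u v ≡ true → col u ≡ col v

  invariant-path : ∀ {C} {col : Fin n → C} → Invariant col → ∀ {u v} → Path A u v → col u ≡ col v
  invariant-path inv stop       = refl
  invariant-path inv (e ◅ p) = trans (inv e) (invariant-path inv p)

  -- Components are monochromatic, so differently coloured vertices have different representatives.
  -- All lower bounds for the number of components come from such colourings.
  colours≤components : ∀ {m C} {col : Fin n → C} → Invariant col → (w : Fin m → Fin n) →
    (∀ {i j} → col (w i) ≡ col (w j) → i ≡ j) → m ≤ components A
  colours≤components {col = col} inv w inj = count-≥-injection
    (λ i → proj₁ (representative (w i)))
    (λ {i} {j} e → inj (trans (colour i) (trans (cong col e) (sym (colour j)))))
    (λ i → proj₁ (proj₂ (representative (w i))))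
    where
    colour : ∀ i → col (w i) ≡ col (proj₁ (representative (w i)))
    colour i = sym (invariant-path inv (proj₂ (proj₂ (representative (w i)))))

-- Tours from cyclic permutations

module _ {n : ℕ} (σ σ⁻ : Fin n → Fin n) where

  cycleGraph : Graph n
  cycleGraph u v = does (v ≟ σ u) ∨ does (v ≟ σ⁻ u)

  cycleGraph-sound : ∀ u v → cycleGraph u v ≡ true → v ≡ σ u ⊎ v ≡ σ⁻ u
  cycleGraph-sound u v e with ∨-true {does (v ≟ σ u)} e
  ... | inj₁ d = inj₁ (does-sound (v ≟ σ u) d)
  ... | inj₂ d = inj₂ (does-sound (v ≟ σ⁻ u) d)

  cycleGraph-succ : ∀ u → cycleGraph u (σ u) ≡ true
  cycleGraph-succ u rewrite does-true (σ u ≟ σ u) refl = refl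

  cycleGraph-pred : ∀ u → cycleGraph u (σ⁻ u) ≡ true
  cycleGraph-pred u = ∨-trueʳ (does (σ⁻ u ≟ σ u)) (does-true (σ⁻ u ≟ σ⁻ u) refl)

  -- Cycles of length one and two are ruled out, so `σ u` and `σ⁻ u` are two different neighbours of
  -- `u`; the orbit of `r` is a walk through all vertices.
  cycleGraph-isTour : (∀ u → σ (σ⁻ u) ≡ u) → (∀ u → σ⁻ (σ u) ≡ u) → (∀ u → σ u ≢ u) →
    (∀ u → σ u ≢ σ⁻ u) → (∃ λ r → ∀ u → Orbit σ r u) → IsTour cycleGraph
  cycleGraph-isTour σσ⁻ σ⁻σ loopless σ≢σ⁻ (r , orbit) =
    ((λ u v → bool-≡ (symm {u} {v}) (symm {v} {u})) , λ u → irreflexive u) , degree , connected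
    where
    symm : ∀ {u v} → cycleGraph u v ≡ true → cycleGraph v u ≡ true
    symm {u} {v} e with cycleGraph-sound u v e
    ... | inj₁ refl = subst (λ x → cycleGraph (σ u) x ≡ true) (σ⁻σ u) (cycleGraph-pred (σ u))
    ... | inj₂ refl = subst (λ x → cycleGraph (σ⁻ u) x ≡ true) (σσ⁻ u) (cycleGraph-succ (σ⁻ u))
    irreflexive : ∀ u → cycleGraph u u ≡ false
    irreflexive u with cycleGraph u u in e
    ... | false = refl
    ... | true with cycleGraph-sound u u e
    ... | inj₁ u≡σu = contradiction (sym u≡σu) (loopless u)
    ... | inj₂ u≡σ⁻u = contradiction (trans (cong σ u≡σ⁻u) (σσ⁻ u)) (loopless u)
    degree : ∀ u → deg cycleGraph u ≡ 2
    degree u = ℕₚ.≤-antisym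
      (count-≤-length (σ u ∷ σ⁻ u ∷ []) λ {v} e → member (cycleGraph-sound u v e))
      (count-≥2 (cycleGraph-succ u) (cycleGraph-pred u) (≢-sym (σ≢σ⁻ u)))
      where
      member : ∀ {v} → v ≡ σ u ⊎ v ≡ σ⁻ u → v ∈ σ u ∷ σ⁻ u ∷ []
      member (inj₁ e) = here e
      member (inj₂ e) = there (here e)
    path : ∀ u i → Path cycleGraph u (fold u σ i)
    path u zero    = stop
    path u (suc i) = path u i ◅◅ (cycleGraph-succ (fold u σ i) ◅ stop)
    from-root : ∀ u → Path cycleGraph r u
    from-root u with orbit u
    ... | i , refl = path r i
    connected : ∀ u v → conn cycleGraph u v ≡ true
    connected u v = conn-complete cycleGraph (reverse (λ {x} {y} → symm {x} {y}) (from-root u) ◅◅ from-root v)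

-- Lengths of tours in terms of the number of edges of cost 2

module _ {n : ℕ} (c : Fin n → Fin n → ℕ) where

  heavy : Graph n → Fin n → ℕ
  heavy A u = countFin (λ v → A u v ∧ not (c u v ≡ᵇ 1))

  -- Each vertex has two tour edges, and each of them costs 1, plus 1 if it is heavy. Everything is
  -- doubled because an edge is seen from both its ends.
  tour-cost : ∀ {A} → IsTour A → (∀ u v → c u v ≡ c v u) → (∀ u v → u ≢ v → c u v ≡ 1 ⊎ c u v ≡ 2) →
    2 * cost c A ≡ n * 2 + sumFin (heavy A)
  tour-cost {A} (simple , degree , _) c-sym c-12 = begin
    2 * cost c A ≡⟨ sym (handshake c A simple c-sym) ⟩
    sumFin (λ u → sumFin (λ v → if A u v then c u v else 0)) ≡⟨ sum-cong row ⟩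
    sumFin (λ u → 2 + heavy A u) ≡⟨ sum-+ (λ _ → 2) (heavy A) ⟩
    sumFin {n} (λ _ → 2) + sumFin (heavy A) ≡⟨ cong (_+ sumFin (heavy A)) (sum-const n 2) ⟩
    n * 2 + sumFin (heavy A) ∎
    where
    open ≡-Reasoning
    entry : ∀ u v → (if A u v then c u v else 0) ≡
      (if A u v then 1 else 0) + (if A u v ∧ not (c u v ≡ᵇ 1) then 1 else 0)
    entry u v with A u v in e
    ... | false = refl
    ... | true with c-12 u v (λ { refl → true≢false e (proj₂ simple u) })
    ... | inj₁ eq rewrite eq = refl
    ... | inj₂ eq rewrite eq = refl
    row : ∀ u → sumFin (λ v → if A u v then c u v else 0) ≡ 2 + heavy A u
    row u = trans (sum-cong (entry u)) (trans (sum-+ {n} _ _) (cong (_+ heavy A u) (degree u)))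

-- The number of edges of a tour leaving a set is even, since twice the size of the set counts
-- these edges once and the inner edges twice.
module _ {n : ℕ} {A : Graph n} (tour : IsTour A) (χ : Fin n → Bool) where

  leaving : Fin n → ℕ
  leaving u = if χ u then countFin (λ v → A u v ∧ not (χ v)) else 0

  inner : Graph n
  inner u v = χ u ∧ (A u v ∧ χ v)

  inner-simple : IsSimple inner
  inner-simple = symm , irr
    where
    symm : ∀ u v → inner u v ≡ inner v u
    symm u v rewrite proj₁ (proj₁ tour) u v with χ u | χ v | A v u
    ... | true  | true  | true  = refl
    ... | true  | true  | false = refl
    ... | true  | false | true  = refl
    ... | true  | false | false = refl
    ... | false | true  | true  = refl
    ... | false | true  | false = refl
    ... | false | false | _     = refl
    irr : ∀ u → inner u u ≡ false
    irr u rewrite proj₂ (proj₁ tour) u with χ u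
    ... | true  = refl
    ... | false = refl

  double-count : countFin χ * 2 ≡ 2 * countPairs inner + sumFin leaving
  double-count = begin
    countFin χ * 2 ≡⟨ ℕₚ.*-comm (countFin χ) 2 ⟩
    countFin χ + (countFin χ + 0) ≡⟨ cong (countFin χ +_) (ℕₚ.+-identityʳ _) ⟩
    countFin χ + countFin χ ≡⟨ sym (sum-+ {n} _ _) ⟩
    sumFin (λ u → (if χ u then 1 else 0) + (if χ u then 1 else 0)) ≡⟨ sum-cong row ⟩
    sumFin (λ u → deg inner u + leaving u) ≡⟨ sum-+ (deg inner) leaving ⟩
    sumFin (deg inner) + sumFin leaving ≡⟨ cong (_+ sumFin leaving) (sum-deg inner inner-simple) ⟩
    2 * countPairs inner + sumFin leaving ∎
    where
    open ≡-Reasoning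
    row : ∀ u → (if χ u then 1 else 0) + (if χ u then 1 else 0) ≡ deg inner u + leaving u
    row u with χ u
    ... | true  = trans (sym (proj₁ (proj₂ tour) u)) (count-split (A u) χ)
    ... | false = sym (trans (ℕₚ.+-identityʳ _) (count-none {n} {λ _ → false} λ _ → refl))

  leaves : ∀ {u v} → Path A u v → χ u ≡ true → χ v ≡ false →
    ∃ λ x → ∃ λ y → A x y ≡ true × χ x ≡ true × χ y ≡ false
  leaves stop χu χv = contradiction χv (true≢false χu)
  leaves (_◅_ {u} {w} e p) χu χv with χ w in χw
  ... | true  = leaves p χw χv
  ... | false = u , w , e , χu , χw

  -- Connectedness provides one leaving edge, and the parity from `double-count` a second one.
  leaving-≥2 : ∀ {u v} → χ u ≡ true → χ v ≡ false → 2 ≤ sumFin leaving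
  leaving-≥2 {u} {v} χu χv with leaves (reachB-sound A n (proj₂ (proj₂ tour) u v)) χu χv
  ... | x , y , e , χx , χy = even (countFin χ) (countPairs inner) (sumFin leaving) double-count
      (ℕₚ.≤-trans at-x (sum-≥-term leaving x))
    where
    at-x : 1 ≤ leaving x
    at-x rewrite χx = count-≥1 y (cong₂ (λ a b → a ∧ not b) e χy)
    even : ∀ a b l → a * 2 ≡ 2 * b + l → 1 ≤ l → 2 ≤ l
    even a b (suc (suc l)) _ _ = s≤s (s≤s z≤n)
    even a b 1 e _ = contradiction
      (trans (ℕₚ.*-comm 2 a) (trans e (ℕₚ.+-comm (2 * b) 1))) (ℕₚ.even≢odd a b)

sum-≤1 : ∀ {m} (p : Fin m → Bool) d → (∀ {i j} → p i ≡ true → p j ≡ true → i ≡ j) →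
  sumFin (λ i → if p i then d else 0) ≤ d
sum-≤1 {zero}  p d unique = z≤n
sum-≤1 {suc m} p d unique with p zero in e
... | false = sum-≤1 (p ∘ suc) d λ a b → Finₚ.suc-injective (unique a b)
... | true = ℕₚ.≤-reflexive (trans
  (cong (d +_) (trans (sum-cong none) (trans (sum-const m 0) (ℕₚ.*-zeroʳ m)))) (ℕₚ.+-identityʳ d))
  where
  none : ∀ i → (if p (suc i) then d else 0) ≡ 0
  none i with p (suc i) in e'
  ... | false = refl
  ... | true with unique e e'
  ... | ()

-- Each colour class is left by at least two edges of the tour, and these have cost 2.
heavy-≥-colours : ∀ {n m} (c : Fin n → Fin n → ℕ) {A : Graph n} → IsTour A →
  (χ : Fin m → Fin n → Bool) → (∀ {i j u} → χ i u ≡ true → χ j u ≡ true → i ≡ j) →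
  (∀ i {u v} → A u v ∧ (c u v ≡ᵇ 1) ≡ true → χ i u ≡ χ i v) →
  (∀ i → ∃ λ u → χ i u ≡ true) → (∀ i → ∃ λ u → χ i u ≡ false) →
  m * 2 ≤ sumFin (heavy c A)
heavy-≥-colours {n} {m} c {A} tour χ disjoint inv inside outside = begin
  m * 2 ≡⟨ sym (sum-const m 2) ⟩
  sumFin {m} (λ _ → 2) ≤⟨ sum-mono (λ i → leaving-≥2 tour (χ i) (proj₂ (inside i)) (proj₂ (outside i))) ⟩
  sumFin (λ i → sumFin (leaving tour (χ i))) ≤⟨ sum-mono (λ i → sum-mono (row i)) ⟩
  sumFin (λ i → sumFin (λ u → if χ i u then heavy c A u else 0)) ≡⟨ sum-swap {m} {n} _ ⟩
  sumFin (λ u → sumFin (λ i → if χ i u then heavy c A u else 0)) ≤⟨ sum-mono (λ u → sum-≤1 (λ i → χ i u) _ disjoint) ⟩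
  sumFin (heavy c A) ∎
  where
  open ℕₚ.≤-Reasoning
  row : ∀ i u → leaving tour (χ i) u ≤ (if χ i u then heavy c A u else 0)
  row i u with χ i u in χu
  ... | false = z≤n
  ... | true = count-mono expensive
    where
    expensive : ∀ v → A u v ∧ not (χ i v) ≡ true → A u v ∧ not (c u v ≡ᵇ 1) ≡ true
    expensive v e with A u v in Auv | c u v ≡ᵇ 1 in cuv
    ... | true | false = refl
    ... | true | true with χ i v in χv
    ... | false = contradiction (trans (sym (inv i (cong₂ _∧_ Auv cuv))) χu) (λ t → true≢false t χv)

-- The graph of the edges of cost 1

data Pentagon : Fin 5 → Fin 5 → Set where
  e01 : Pentagon 0F 1F
  e12 : Pentagon 1F 2F
  e23 : Pentagon 2F 3F
  e34 : Pentagon 3F 4F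
  e04 : Pentagon 0F 4F

-- The gadget of a vertex v consists of two pentagons, one for each visit (v , s) of the circuit,
-- joined by a bridge between their vertices 4.  It is spanned by the path 0 1 2 3 4 4 3 2 1 0,
-- whereas the optimal tour follows the circuit and traverses each pentagon as 1 0 4 3 2.
module Gadgets (H : Circuit) where
  open Circuit H

  Local : Set
  Local = Bool × Fin 5

  X : Set
  X = (V × Bool) × Fin 5

  infix 8 _at_
  _at_ : V → Local → X
  v at (s , i) = (v , s) , i

  gadget : X → V
  gadget ((v , _) , _) = v

  _≟ˣ_ : DecidableEquality X
  _≟ˣ_ = ≡-dec _≟ᵖ_ _≟_

  data Edge : X → X → Set where
    side   : ∀ p {i j} → Pentagon i j → Edge (p , i) (p , j)
    bridge : ∀ v → Edge ((v , false) , 4F) ((v , true) , 4F)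
    cross  : ∀ p → Edge (p , 2F) (next p , 1F)

  Adj : X → X → Set
  Adj x y = Edge x y ⊎ Edge y x

  Adj-sym : ∀ {x y} → Adj x y → Adj y x
  Adj-sym (inj₁ e) = inj₂ e
  Adj-sym (inj₂ e) = inj₁ e

  -- These lists follow the orientation that the constructors of `Edge` give to the edges, and
  -- reduce the decision of `Edge` to list membership.
  targets : X → List X
  targets (p , 0F) = (p , 1F) ∷ (p , 4F) ∷ []
  targets (p , 1F) = (p , 2F) ∷ []
  targets (p , 2F) = (p , 3F) ∷ (next p , 1F) ∷ []
  targets (p , 3F) = (p , 4F) ∷ []
  targets ((v , false) , 4F) = ((v , true) , 4F) ∷ []
  targets ((v , true)  , 4F) = []

  edge⇒target : ∀ {x y} → Edge x y → y ∈ targets x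
  edge⇒target (side p e01) = here refl
  edge⇒target (side p e12) = here refl
  edge⇒target (side p e23) = here refl
  edge⇒target (side p e34) = here refl
  edge⇒target (side p e04) = there (here refl)
  edge⇒target (bridge v)   = here refl
  edge⇒target (cross p)    = there (here refl)

  target⇒edge : ∀ x {y} → y ∈ targets x → Edge x y
  target⇒edge (p , 0F) (here refl)         = side p e01
  target⇒edge (p , 0F) (there (here refl)) = side p e04
  target⇒edge (p , 1F) (here refl)         = side p e12
  target⇒edge (p , 2F) (here refl)         = side p e23
  target⇒edge (p , 2F) (there (here refl)) = cross p
  target⇒edge (p , 3F) (here refl)         = side p e34
  target⇒edge ((v , false) , 4F) (here refl) = bridge v

  edge? : ∀ x y → Dec (Edge x y)
  edge? x y = map′ (target⇒edge x) edge⇒target (any? (y ≟ˣ_) (targets x))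

  abstract
    adj? : ∀ x y → Dec (Adj x y)
    adj? x y = edge? x y ⊎-dec edge? y x

  -- Colourings witnessing many components

  module Matching (b : X → X → Bool) (b-sym : ∀ {x y} → b x y ≡ true → b y x ≡ true)
    (b-adj : ∀ {x y} → b x y ≡ true → Adj x y)
    (b-deg : ∀ {x y z w} → b x y ≡ true → b x z ≡ true → b x w ≡ true → z ≢ y → w ≢ y → w ≢ z → ⊥)
    (loopless : ∀ p → tail p ≢ head p) where

    Used : V × Bool → Set
    Used p = b (p , 2F) (next p , 1F) ≡ true

    record Respects (v : V) (κ : Local → Bool) : Set where
      field
        on-side   : ∀ s {i j} → Pentagon i j → b ((v , s) , i) ((v , s) , j) ≡ true → κ (s , i) ≡ κ (s , j)
        on-bridge : b ((v , false) , 4F) ((v , true) , 4F) ≡ true → κ (false , 4F) ≡ κ (true , 4F)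
    open Respects

    -- A certificate that the chosen edges leave the gadget of `v` disconnected, with some `l'` in
    -- another piece than `l`.
    Split : V → Local → Set
    Split v l = Σ (Local → Bool) λ κ → Respects v κ × ∃ λ l' → κ l' ≢ κ l

    bridge-cut : ∀ v → b ((v , false) , 4F) ((v , true) , 4F) ≡ false → ∀ l → Split v l
    bridge-cut v cut (s , i) = proj₁ , record
      { on-side = λ _ _ _ → refl ; on-bridge = λ e → contradiction cut (true≢false e) } , (not s , 0F) , other s
      where
      other : ∀ s → not s ≢ s
      other true  ()
      other false ()

    -- The other pentagon is painted throughout with the colour of the vertex 4 of this one, so the
    -- bridge respects the colours.
    pentagon-cut : ∀ v s (κ : Fin 5 → Bool) →
      (∀ {i j} → Pentagon i j → b ((v , s) , i) ((v , s) , j) ≡ true → κ i ≡ κ j) →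
      ∀ i → (∃ λ j → κ j ≢ κ i) → Split v (s , i)
    pentagon-cut v s κ respects i (j , ne) = κ' , record { on-side = sides ; on-bridge = λ _ → bridges s } ,
        (s , j) , λ e → ne (trans (sym (same j)) (trans e (same i)))
      where
      κ' : Local → Bool
      κ' (t , j) = if does (t ≟ᵇ s) then κ j else κ 4F
      same : ∀ j → κ' (s , j) ≡ κ j
      same j rewrite does-true (s ≟ᵇ s) refl = refl
      sides : ∀ t {i j} → Pentagon i j → b ((v , t) , i) ((v , t) , j) ≡ true → κ' (t , i) ≡ κ' (t , j)
      sides t e u with t ≟ᵇ s
      ... | yes refl = respects e u
      ... | no _     = refl
      bridges : ∀ s → (if does (false ≟ᵇ s) then κ 4F else κ 4F) ≡ (if does (true ≟ᵇ s) then κ 4F else κ 4F)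
      bridges true  = refl
      bridges false = refl

    -- A cross edge and the bridge leave each only one pentagon edge at their ends, and these
    -- ends are not adjacent: two sides are missing.
    end-split : ∀ v s i → i ≡ 1F ⊎ i ≡ 2F → ∀ {y} → b ((v , s) , i) y ≡ true →
      (∀ j → y ≢ ((v , s) , j)) → Split v (s , i)
    end-split v s i i∈ {y} cross-used outside with b ((v , false) , 4F) ((v , true) , 4F) in bridge-eq
    ... | false = bridge-cut v bridge-eq (s , i)
    ... | true = cases i i∈ cross-used missing₄
      where
      β : Fin 5 → Fin 5 → Bool
      β i j = b ((v , s) , i) ((v , s) , j)
      bridge-end : ∀ s → ∃ λ z → b ((v , s) , 4F) z ≡ true × (∀ j → z ≢ ((v , s) , j))
      bridge-end false = _ , bridge-eq , λ _ ()
      bridge-end true  = _ , b-sym bridge-eq , λ _ ()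
      missing : ∀ {i j k z} → b ((v , s) , i) z ≡ true → (∀ j → z ≢ ((v , s) , j)) → j ≢ k →
        β i j ≡ false ⊎ β i k ≡ false
      missing {i} {j} {k} bz ext ne with β i j in e₁ | β i k in e₂
      ... | false | _     = inj₁ refl
      ... | true  | false = inj₂ refl
      ... | true  | true  with b-deg e₁ e₂ bz (λ { refl → ne refl }) (ext j) (ext k)
      ... | ()
      off : ∀ {x y} → b x y ≡ false → b y x ≡ true → ∀ {A : Set} → A
      off f t = contradiction f (true≢false (b-sym t))
      off' : ∀ {x y} → b x y ≡ false → b x y ≡ true → ∀ {A : Set} → A
      off' f t = contradiction f (true≢false t)
      missing₄ : β 4F 0F ≡ false ⊎ β 4F 3F ≡ false
      missing₄ with bridge-end s
      ... | z , bz , ext = missing bz ext λ ()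
      -- Two missing sides cut the pentagon into two arcs; each of these functions marks one of the
      -- arcs for some combination of missing sides below.
      κ₁ κ₂ κ₃ κ₄ κ₅ κ₆ : Fin 5 → Bool
      κ₁ 0F = true
      κ₁ _  = false
      κ₂ 0F = true
      κ₂ 1F = true
      κ₂ _  = false
      κ₃ 0F = true
      κ₃ 4F = true
      κ₃ _  = false
      κ₄ 2F = true
      κ₄ 3F = true
      κ₄ _  = false
      κ₅ 3F = true
      κ₅ 4F = true
      κ₅ _  = false
      κ₆ 3F = true
      κ₆ _  = false
      cases : ∀ i → i ≡ 1F ⊎ i ≡ 2F → b ((v , s) , i) y ≡ true →
        β 4F 0F ≡ false ⊎ β 4F 3F ≡ false → Split v (s , i)
      cases 1F _ used m₄ with m₄ | missing {1F} {0F} {2F} used outside (λ ())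
      ... | inj₁ m | inj₁ m' = pentagon-cut v s κ₁
        (λ { e01 t → off m' t ; e12 _ → refl ; e23 _ → refl ; e34 _ → refl ; e04 t → off m t }) 1F (0F , λ ())
      ... | inj₁ m | inj₂ m' = pentagon-cut v s κ₂
        (λ { e01 _ → refl ; e12 t → off' m' t ; e23 _ → refl ; e34 _ → refl ; e04 t → off m t }) 1F (2F , λ ())
      ... | inj₂ m | inj₁ m' = pentagon-cut v s κ₃
        (λ { e01 t → off m' t ; e12 _ → refl ; e23 _ → refl ; e34 t → off m t ; e04 _ → refl }) 1F (0F , λ ())
      ... | inj₂ m | inj₂ m' = pentagon-cut v s κ₄
        (λ { e01 _ → refl ; e12 t → off' m' t ; e23 _ → refl ; e34 t → off m t ; e04 _ → refl }) 1F (2F , λ ())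
      cases 2F _ used m₄ with m₄ | missing {2F} {1F} {3F} used outside (λ ())
      ... | inj₁ m | inj₁ m' = pentagon-cut v s κ₂
        (λ { e01 _ → refl ; e12 t → off m' t ; e23 _ → refl ; e34 _ → refl ; e04 t → off m t }) 2F (0F , λ ())
      ... | inj₁ m | inj₂ m' = pentagon-cut v s κ₅
        (λ { e01 _ → refl ; e12 _ → refl ; e23 t → off' m' t ; e34 _ → refl ; e04 t → off m t }) 2F (3F , λ ())
      ... | inj₂ m | inj₁ m' = pentagon-cut v s κ₄
        (λ { e01 _ → refl ; e12 t → off m' t ; e23 _ → refl ; e34 t → off m t ; e04 _ → refl }) 2F (0F , λ ())
      ... | inj₂ m | inj₂ m' = pentagon-cut v s κ₆
        (λ { e01 _ → refl ; e12 _ → refl ; e23 t → off' m' t ; e34 t → off m t ; e04 _ → refl }) 2F (3F , λ ())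
      cases 0F (inj₁ ())
      cases 0F (inj₂ ())
      cases 3F (inj₁ ())
      cases 3F (inj₂ ())
      cases 4F (inj₁ ())
      cases 4F (inj₂ ())

    -- The edge p seen from one of its ends y: it uses the vertex place of the gadget of y and the
    -- vertex other outside this gadget.
    record End (p : V × Bool) (y : V) : Set₁ where
      field
        place : Local
        other : X
        split : Split y place
        apart : gadget other ≢ y
        ends  : ∀ {C : Set} (col : X → C) → col (y at place) ≡ col other → col (p , 2F) ≡ col (next p , 1F)

    tail-end : ∀ p → Used p → End p (tail p)
    tail-end (v , s) used = record
      { place = s , 2F ; other = next (v , s) , 1F
      ; split = end-split v s 2F (inj₂ refl) used λ { j e → loopless (v , s) (sym (cong gadget e)) }
      ; apart = λ e → loopless (v , s) (sym e)
      ; ends = λ _ e → e }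

    head-end : ∀ p → Used p → End p (head p)
    head-end p used = record
      { place = proj₂ (next p) , 1F ; other = p , 2F
      ; split = end-split (proj₁ (next p)) (proj₂ (next p)) 1F (inj₁ refl) (b-sym used)
          λ { j e → loopless p (cong gadget e) }
      ; apart = loopless p
      ; ends = λ _ e → sym e }

    incident-end : ∀ {p y} → Used p → Incident p y → End p y
    incident-end used (inj₁ refl) = tail-end _ used
    incident-end used (inj₂ refl) = head-end _ used

    -- The colours `just v` account for one component per gadget. The spare colour `nothing` is for
    -- the second piece of the gadget chosen as root.
    record Colouring (S : List (V × Bool)) : Set where
      field
        col      : X → Maybe V
        along-side   : ∀ p {i j} → Pentagon i j → b (p , i) (p , j) ≡ true → col (p , i) ≡ col (p , j)
        along-bridge : ∀ v → b ((v , false) , 4F) ((v , true) , 4F) ≡ true →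
          col ((v , false) , 4F) ≡ col ((v , true) , 4F)
        along-cross  : ∀ {p} → p ∈ S → col (p , 2F) ≡ col (next p , 1F)
        onto     : ∀ v → ∃ λ x → col x ≡ just v
    open Colouring

    gadget-colouring : Colouring []
    gadget-colouring = record
      { col = just ∘ gadget ; along-side = λ _ _ _ → refl ; along-bridge = λ _ _ → refl
      ; along-cross = λ () ; onto = λ v → v at (false , 0F) , refl }

    -- The forest S is built up from the gadget z by adding leaves: a new leaf y was coloured just y
    -- throughout, and the part of it that its edge reaches takes the colour of the other end.
    module Grow {K : ℕ} (forests : Forests K H) (z : V) (l : Local) (split-z : Split z l) where

      -- The last condition says that gadgets not yet reached are intact, which allows them to be
      -- attached as leaves later.
      Rooted : List (V × Bool) → Set
      Rooted S = Σ (Colouring S) λ c → (∃ λ x → col c x ≡ nothing) ×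
        (∀ {v} → v ≢ z → (∀ {p} → p ∈ S → ¬ Incident p v) → ∀ l → col c (v at l) ≡ just v)

      start : Rooted []
      start = record { col = col₀ ; along-side = sides ; along-bridge = bridges ; along-cross = λ ()
                     ; onto = onto₀ } , (z at l₁ , second) , λ ne _ l → plain ne l
        where
        κ = proj₁ split-z
        respects = proj₁ (proj₂ split-z)
        l₁ = proj₁ (proj₂ (proj₂ split-z))
        ne₁ = proj₂ (proj₂ (proj₂ split-z))
        col₀ : X → Maybe V
        col₀ ((v , s) , i) = if does (v ≟ᵛ z) then (if does (κ (s , i) ≟ᵇ κ l) then just z else nothing) else just v
        plain : ∀ {v} → v ≢ z → ∀ l → col₀ (v at l) ≡ just v
        plain {v} ne l with v ≟ᵛ z
        ... | yes e = contradiction e ne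
        ... | no _  = refl
        sides : ∀ p {i j} → Pentagon i j → b (p , i) (p , j) ≡ true → col₀ (p , i) ≡ col₀ (p , j)
        sides (v , s) e u with v ≟ᵛ z
        ... | yes refl rewrite on-side respects s e u = refl
        ... | no _ = refl
        bridges : ∀ v → b ((v , false) , 4F) ((v , true) , 4F) ≡ true →
          col₀ ((v , false) , 4F) ≡ col₀ ((v , true) , 4F)
        bridges v u with v ≟ᵛ z
        ... | yes refl rewrite on-bridge respects u = refl
        ... | no _ = refl
        first : col₀ (z at l) ≡ just z
        first rewrite does-true (z ≟ᵛ z) refl | does-true (κ l ≟ᵇ κ l) refl = refl
        second : col₀ (z at l₁) ≡ nothing
        second rewrite does-true (z ≟ᵛ z) refl with κ l₁ ≟ᵇ κ l
        ... | yes e = contradiction e ne₁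
        ... | no _  = refl
        onto₀ : ∀ v → ∃ λ x → col₀ x ≡ just v
        onto₀ v with v ≟ᵛ z
        ... | yes refl = z at l , first
        ... | no ne    = v at l , plain ne l

      attach : ∀ {S S' y} → y ≢ z → (leaf : Leaf S y) → Used (proj₁ leaf) →
        (∀ {p} → p ∈ S' → p ∈ S × p ≢ proj₁ leaf) → (∀ {p} → p ∈ S → p ≢ proj₁ leaf → p ∈ S') →
        Rooted S' → Rooted S
      attach {S} {S'} {y} y≢z (q , q∈ , inc , only , _) used S'⊆ ⊆S' (c , (x₀ , extra) , plain) =
        record { col = col' ; along-side = sides ; along-bridge = bridges ; along-cross = crosses ; onto = onto' } ,
        -- A vertex coloured `nothing` is outside the gadget of `y`, which had the single colour
        -- `just y`, so it keeps its colour.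
        (x₀ , trans (unchanged x₀ λ { refl → contradiction (trans (sym extra) (plain-y _)) λ () }) extra) ,
        λ {v} ne free l → trans (unchanged (v at l) λ { refl → free q∈ inc })
          (plain ne (λ p∈ → free (proj₁ (S'⊆ p∈))) l)
        where
        open End (incident-end used inc)
        κ = proj₁ split
        respects = proj₁ (proj₂ split)
        l₁ = proj₁ (proj₂ (proj₂ split))
        ne₁ = proj₂ (proj₂ (proj₂ split))
        plain-y : ∀ l → col c (y at l) ≡ just y
        plain-y = plain y≢z λ p∈ i → proj₂ (S'⊆ p∈) (only (proj₁ (S'⊆ p∈)) i)
        col' : X → Maybe V
        col' ((v , s) , i) = if does (v ≟ᵛ y)
          then (if does (κ (s , i) ≟ᵇ κ place) then col c other else just y)
          else col c ((v , s) , i)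
        unchanged : ∀ x → gadget x ≢ y → col' x ≡ col c x
        unchanged ((v , s) , i) ne with v ≟ᵛ y
        ... | yes e = contradiction e ne
        ... | no _  = refl
        sides : ∀ p {i j} → Pentagon i j → b (p , i) (p , j) ≡ true → col' (p , i) ≡ col' (p , j)
        sides (v , s) e u with v ≟ᵛ y
        ... | yes refl rewrite on-side respects s e u = refl
        ... | no _ = along-side c (v , s) e u
        bridges : ∀ v → b ((v , false) , 4F) ((v , true) , 4F) ≡ true →
          col' ((v , false) , 4F) ≡ col' ((v , true) , 4F)
        bridges v u with v ≟ᵛ y
        ... | yes refl rewrite on-bridge respects u = refl
        ... | no _ = along-bridge c v u
        attached : col' (y at place) ≡ col c other
        attached rewrite does-true (y ≟ᵛ y) refl | does-true (κ place ≟ᵇ κ place) refl = refl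
        remaining : col' (y at l₁) ≡ just y
        remaining rewrite does-true (y ≟ᵛ y) refl with κ l₁ ≟ᵇ κ place
        ... | yes e = contradiction e ne₁
        ... | no _  = refl
        crosses : ∀ {p} → p ∈ S → col' (p , 2F) ≡ col' (next p , 1F)
        crosses {p} p∈ with p ≟ᵖ q
        ... | yes refl = ends col' (trans attached (sym (unchanged other apart)))
        -- Since `y` is a leaf, no other edge of `S` meets the recoloured gadget.
        ... | no ne = trans (unchanged (p , 2F) (λ e → ne (only p∈ (inj₁ e))))
          (trans (along-cross c (⊆S' p∈ ne)) (sym (unchanged (next p , 1F) (λ e → ne (only p∈ (inj₂ e))))))
        onto' : ∀ v → ∃ λ x → col' x ≡ just v
        onto' v with v ≟ᵛ y
        ... | yes refl = y at l₁ , remaining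
        ... | no ne with onto c v
        ... | x , e = x , trans (unchanged x λ { refl → ne (just-injective (trans (sym e) (plain-y _))) }) e

      -- `Forests` yields a leaf other than the root `z`; its edge is removed, the rest is coloured,
      -- and the leaf is attached again. The number `n` bounds the recursion.
      grow : ∀ n S → length S ≤ n → length S ≤ K → (∀ {p} → p ∈ S → Used p) → Rooted S
      grow n [] _ _ _ = start
      grow (suc n) S@(p ∷ _) (s≤s le) short used with forests S short (here refl) z
      ... | y , y≢z , leaf@(q , q∈ , _) = attach y≢z leaf (used q∈)
          (∈-filter⁻ other? {xs = S}) (λ p∈ ne → ∈-filter⁺ other? p∈ ne)
          (grow n S' (ℕₚ.≤-pred (ℕₚ.≤-trans shorter (s≤s le))) (ℕₚ.≤-trans (ℕₚ.<⇒≤ shorter) short)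
            (λ p∈ → used (proj₁ (∈-filter⁻ other? {xs = S} p∈))))
        where
        other? : ∀ p → Dec (p ≢ q)
        other? p = ¬? (p ≟ᵖ q)
        S' = filter other? S
        shorter : length S' ℕ.< length S
        shorter = filter-notAll other? S (Any.map (λ { refl ¬p → ¬p refl }) q∈)

    colouring : ∀ {K} → Forests K H → ∀ S → length S ≤ K → (∀ {p} → p ∈ S → Used p) → Colouring S
    colouring forests [] _ _ = gadget-colouring
    colouring forests S@(p ∷ _) short used =
      proj₁ (Grow.grow forests (tail p) place split (length S) S ℕₚ.≤-refl short used)
      where open End (tail-end p (used (here refl)))

    col-invariant : ∀ {S} (c : Colouring S) → (∀ {p} → Used p → p ∈ S) →
      ∀ {x y} → b x y ≡ true → col c x ≡ col c y
    col-invariant c covers u = [ (λ e → along e u) , (λ e → sym (along e (b-sym u))) ]′ (b-adj u)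
      where
      along : ∀ {x y} → Edge x y → b x y ≡ true → col c x ≡ col c y
      along (side p s) = along-side c p s
      along (bridge v) = along-bridge c v
      along (cross p)  = λ u → along-cross c (covers u)

-- The instance

module Construction (H : Circuit) (K : ℕ) (1≤K : 1 ≤ K) (forests : Forests K H) where
  open Circuit H
  open Gadgets H

  -- A single edge is already a forest, and the edge at a leaf is no loop.
  loopless : ∀ p → tail p ≢ head p
  loopless p with forests (p ∷ []) 1≤K (here refl) (tail p)
  ... | _ , _ , q , here refl , _ , _ , nl = nl

  -- The forest of a single edge has a leaf other than `v`. This ensures that no colour class
  -- contains all vertices.
  another : ∀ v → ∃ λ v' → v' ≢ v
  another v with forests ((v , true) ∷ []) 1≤K (here refl) v
  ... | v' , ne , _ = v' , ne

  M : ℕ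
  M = suc size⁻

  gadgetAt : Fin M → V
  gadgetAt = Inverse.from finite

  index : V → Fin M
  index = Inverse.to finite

  gadgetAt-index : ∀ v → gadgetAt (index v) ≡ v
  gadgetAt-index = Inverse.strictlyInverseʳ finite

  index-gadgetAt : ∀ i → index (gadgetAt i) ≡ i
  index-gadgetAt = Inverse.strictlyInverseˡ finite

  abstract
    N : ℕ
    N = M * 2 * 5

    N≡ : N ≡ M * 2 * 5
    N≡ = refl

    3≤N : 3 ≤ N
    3≤N = s≤s (s≤s (s≤s z≤n))

    numbering : X ↔ Fin N
    numbering = ↔-trans (↔-trans (finite ×-↔ ↔-sym Finₚ.2↔Bool) (↔-sym (Finₚ.*↔× {M} {2})) ×-↔ ↔-refl)
      (↔-sym (Finₚ.*↔× {M * 2} {5}))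

  to : X → Fin N
  to = Inverse.to numbering

  from : Fin N → X
  from = Inverse.from numbering

  to-from : ∀ u → to (from u) ≡ u
  to-from = Inverse.strictlyInverseˡ numbering

  from-to : ∀ x → from (to x) ≡ x
  from-to = Inverse.strictlyInverseʳ numbering

  to-injective : ∀ {x y} → to x ≡ to y → x ≡ y
  to-injective {x} {y} e = trans (sym (from-to x)) (trans (cong from e) (from-to y))

  length-c : Fin N → Fin N → ℕ
  length-c u v = if does (adj? (from u) (from v)) then 1 else 2

  I : Instance
  I = record
    { n = N
    ; 3≤n = 3≤N
    ; c = length-c
    ; c-sym = λ u v → cong (λ b → if b then 1 else 2) (symmetric (from u) (from v))
    ; c-12 = λ u v _ → one-or-two (does (adj? (from u) (from v)))
    }
    where
    one-or-two : ∀ b → (if b then 1 else 2) ≡ 1 ⊎ (if b then 1 else 2) ≡ 2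
    one-or-two true  = inj₁ refl
    one-or-two false = inj₂ refl
    symmetric : ∀ x y → does (adj? x y) ≡ does (adj? y x)
    symmetric x y with adj? x y | adj? y x
    ... | yes _ | yes _ = refl
    ... | no _  | no _  = refl
    ... | yes a | no ¬a = contradiction (Adj-sym a) ¬a
    ... | no ¬a | yes a = contradiction (Adj-sym a) ¬a

  short-adj : ∀ {u v} → length-c u v ≡ 1 → Adj (from u) (from v)
  short-adj {u} {v} e with adj? (from u) (from v)
  ... | yes a = a

  adj-short : ∀ {u v} → Adj (from u) (from v) → length-c u v ≡ 1
  adj-short {u} {v} a rewrite does-true (adj? (from u) (from v)) a = refl

  ≡ᵇ1-sound : ∀ {m} → (m ≡ᵇ 1) ≡ true → m ≡ 1
  ≡ᵇ1-sound {1} _ = refl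

  -- A permutation with a single cycle, of length at least three by `f-≢` and `f-≢-f⁻`; it describes
  -- a tour independently of the numbering of the vertices.
  record Rotation : Set where
    field
      f f⁻    : X → X
      f-f⁻    : ∀ x → f (f⁻ x) ≡ x
      f⁻-f    : ∀ x → f⁻ (f x) ≡ x
      f-≢     : ∀ x → f x ≢ x
      f-≢-f⁻  : ∀ x → f x ≢ f⁻ x
      base    : X
      cyclic  : ∀ x → Orbit f base x

  module TourOf (R : Rotation) where
    open Rotation R

    σ σ⁻ : Fin N → Fin N
    σ u = to (f (from u))
    σ⁻ u = to (f⁻ (from u))

    tour : Graph N
    tour = cycleGraph σ σ⁻

    tour-sound : ∀ u v → tour u v ≡ true → from v ≡ f (from u) ⊎ from v ≡ f⁻ (from u)
    tour-sound u v e with cycleGraph-sound σ σ⁻ u v e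
    ... | inj₁ refl = inj₁ (from-to _)
    ... | inj₂ refl = inj₂ (from-to _)

    tour-succ : ∀ x → tour (to x) (to (f x)) ≡ true
    tour-succ x = subst (λ y → tour (to x) (to (f y)) ≡ true) (from-to x) (cycleGraph-succ σ σ⁻ (to x))

    tour-pred : ∀ x → tour (to x) (to (f⁻ x)) ≡ true
    tour-pred x = subst (λ y → tour (to x) (to (f⁻ y)) ≡ true) (from-to x) (cycleGraph-pred σ σ⁻ (to x))

    isTour : IsTour tour
    isTour = cycleGraph-isTour σ σ⁻
      (λ u → trans (cong (to ∘ f) (from-to _)) (trans (cong to (f-f⁻ (from u))) (to-from u)))
      (λ u → trans (cong (to ∘ f⁻) (from-to _)) (trans (cong to (f⁻-f (from u))) (to-from u)))
      (λ u e → f-≢ (from u) (trans (sym (from-to _)) (cong from e)))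
      (λ u e → f-≢-f⁻ (from u) (to-injective e))
      (to base , orbit)
      where
      fold-σ : ∀ i → fold (to base) σ i ≡ to (fold base f i)
      fold-σ zero    = refl
      fold-σ (suc i) = trans (cong σ (fold-σ i)) (cong (to ∘ f) (from-to _))
      orbit : ∀ u → Orbit σ (to base) u
      orbit u with cyclic (from u)
      ... | i , e = i , trans (fold-σ i) (trans (cong to e) (to-from u))

  optimalRotation : Rotation
  optimalRotation = record
    { f = f ; f⁻ = f⁻ ; f-f⁻ = f-f⁻ ; f⁻-f = f⁻-f ; f-≢ = f-≢ ; f-≢-f⁻ = f-≢-f⁻
    ; base = root , 1F ; cyclic = cyclic }
    where
    f f⁻ : X → X
    f (p , 0F) = p , 4F
    f (p , 1F) = p , 0F
    f (p , 2F) = next p , 1F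
    f (p , 3F) = p , 2F
    f (p , 4F) = p , 3F
    f⁻ (p , 0F) = p , 1F
    f⁻ (p , 1F) = prev p , 2F
    f⁻ (p , 2F) = p , 3F
    f⁻ (p , 3F) = p , 4F
    f⁻ (p , 4F) = p , 0F
    f-f⁻ : ∀ x → f (f⁻ x) ≡ x
    f-f⁻ (p , 0F) = refl
    f-f⁻ (p , 1F) = cong (_, 1F) (next-prev p)
    f-f⁻ (p , 2F) = refl
    f-f⁻ (p , 3F) = refl
    f-f⁻ (p , 4F) = refl
    f⁻-f : ∀ x → f⁻ (f x) ≡ x
    f⁻-f (p , 0F) = refl
    f⁻-f (p , 1F) = refl
    f⁻-f (p , 2F) = cong (_, 2F) (prev-next p)
    f⁻-f (p , 3F) = refl
    f⁻-f (p , 4F) = refl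
    f-≢ : ∀ x → f x ≢ x
    f-≢ (p , 0F) ()
    f-≢ (p , 1F) ()
    f-≢ (p , 2F) ()
    f-≢ (p , 3F) ()
    f-≢ (p , 4F) ()
    f-≢-f⁻ : ∀ x → f x ≢ f⁻ x
    f-≢-f⁻ (p , 0F) ()
    f-≢-f⁻ (p , 1F) ()
    f-≢-f⁻ (p , 2F) ()
    f-≢-f⁻ (p , 3F) ()
    f-≢-f⁻ (p , 4F) ()
    entry : ∀ i → Orbit f (root , 1F) (fold root next i , 1F)
    entry zero    = 0 , refl
    -- Five steps traverse a pentagon and enter the next one on the circuit.
    entry (suc i) = orbit-trans f (entry i) (5 , refl)
    inside : ∀ p j → Orbit f (p , 1F) (p , j)
    inside p 0F = 1 , refl
    inside p 1F = 0 , refl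
    inside p 2F = 4 , refl
    inside p 3F = 3 , refl
    inside p 4F = 2 , refl
    cyclic : ∀ x → Orbit f (root , 1F) x
    cyclic (p , j) with single p
    ... | i , refl = orbit-trans f (entry i) (inside _ j)

  turn turn⁻ : V → V
  turn v = gadgetAt (rot (index v))
  turn⁻ v = gadgetAt (rot⁻ (index v))

  -- Consecutive paths are linked between two vertices 0, which are never adjacent, so each link
  -- costs 2. The order of the gadgets comes from their numbering and has nothing to do with the
  -- circuit.
  pathRotation : Rotation
  pathRotation = record
    { f = f ; f⁻ = f⁻ ; f-f⁻ = f-f⁻ ; f⁻-f = f⁻-f ; f-≢ = f-≢ ; f-≢-f⁻ = f-≢-f⁻
    ; base = start , 0F ; cyclic = cyclic }
    where
    start : V × Bool
    start = gadgetAt zero , false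
    f f⁻ : X → X
    f ((v , false) , 0F) = (v , false) , 1F
    f ((v , false) , 1F) = (v , false) , 2F
    f ((v , false) , 2F) = (v , false) , 3F
    f ((v , false) , 3F) = (v , false) , 4F
    f ((v , false) , 4F) = (v , true) , 4F
    f ((v , true) , 4F) = (v , true) , 3F
    f ((v , true) , 3F) = (v , true) , 2F
    f ((v , true) , 2F) = (v , true) , 1F
    f ((v , true) , 1F) = (v , true) , 0F
    f ((v , true) , 0F) = (turn v , false) , 0F
    f⁻ ((v , false) , 0F) = (turn⁻ v , true) , 0F
    f⁻ ((v , false) , 1F) = (v , false) , 0F
    f⁻ ((v , false) , 2F) = (v , false) , 1F
    f⁻ ((v , false) , 3F) = (v , false) , 2F
    f⁻ ((v , false) , 4F) = (v , false) , 3F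
    f⁻ ((v , true) , 4F) = (v , false) , 4F
    f⁻ ((v , true) , 3F) = (v , true) , 4F
    f⁻ ((v , true) , 2F) = (v , true) , 3F
    f⁻ ((v , true) , 1F) = (v , true) , 2F
    f⁻ ((v , true) , 0F) = (v , true) , 1F
    turn-turn⁻ : ∀ v → turn (turn⁻ v) ≡ v
    turn-turn⁻ v = trans (cong (gadgetAt ∘ rot) (index-gadgetAt _))
      (trans (cong gadgetAt (rot-rot⁻ (index v))) (gadgetAt-index v))
    turn⁻-turn : ∀ v → turn⁻ (turn v) ≡ v
    turn⁻-turn v = trans (cong (gadgetAt ∘ rot⁻) (index-gadgetAt _))
      (trans (cong gadgetAt (rot⁻-rot (index v))) (gadgetAt-index v))
    f-f⁻ : ∀ x → f (f⁻ x) ≡ x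
    f-f⁻ ((v , false) , 0F) = cong (λ w → (w , false) , 0F) (turn-turn⁻ v)
    f-f⁻ ((v , false) , 1F) = refl
    f-f⁻ ((v , false) , 2F) = refl
    f-f⁻ ((v , false) , 3F) = refl
    f-f⁻ ((v , false) , 4F) = refl
    f-f⁻ ((v , true) , 0F) = refl
    f-f⁻ ((v , true) , 1F) = refl
    f-f⁻ ((v , true) , 2F) = refl
    f-f⁻ ((v , true) , 3F) = refl
    f-f⁻ ((v , true) , 4F) = refl
    f⁻-f : ∀ x → f⁻ (f x) ≡ x
    f⁻-f ((v , false) , 0F) = refl
    f⁻-f ((v , false) , 1F) = refl
    f⁻-f ((v , false) , 2F) = refl
    f⁻-f ((v , false) , 3F) = refl
    f⁻-f ((v , false) , 4F) = refl
    f⁻-f ((v , true) , 0F) = cong (λ w → (w , true) , 0F) (turn⁻-turn v)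
    f⁻-f ((v , true) , 1F) = refl
    f⁻-f ((v , true) , 2F) = refl
    f⁻-f ((v , true) , 3F) = refl
    f⁻-f ((v , true) , 4F) = refl
    f-≢ : ∀ x → f x ≢ x
    f-≢ ((v , false) , 0F) ()
    f-≢ ((v , false) , 1F) ()
    f-≢ ((v , false) , 2F) ()
    f-≢ ((v , false) , 3F) ()
    f-≢ ((v , false) , 4F) ()
    f-≢ ((v , true) , 0F) ()
    f-≢ ((v , true) , 1F) ()
    f-≢ ((v , true) , 2F) ()
    f-≢ ((v , true) , 3F) ()
    f-≢ ((v , true) , 4F) ()
    f-≢-f⁻ : ∀ x → f x ≢ f⁻ x
    f-≢-f⁻ ((v , false) , 0F) ()
    f-≢-f⁻ ((v , false) , 1F) ()
    f-≢-f⁻ ((v , false) , 2F) ()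
    f-≢-f⁻ ((v , false) , 3F) ()
    f-≢-f⁻ ((v , false) , 4F) ()
    f-≢-f⁻ ((v , true) , 0F) ()
    f-≢-f⁻ ((v , true) , 1F) ()
    f-≢-f⁻ ((v , true) , 2F) ()
    f-≢-f⁻ ((v , true) , 3F) ()
    f-≢-f⁻ ((v , true) , 4F) ()
    entry : ∀ i → Orbit f (start , 0F) ((gadgetAt (fold zero rot i) , false) , 0F)
    entry zero    = 0 , refl
    entry (suc i) = orbit-trans f (entry i)
      (10 , cong (λ g → (gadgetAt (rot g) , false) , 0F) (index-gadgetAt (fold zero rot i)))
    inside : ∀ v l → Orbit f ((v , false) , 0F) (v at l)
    inside v (false , 0F) = 0 , refl
    inside v (false , 1F) = 1 , refl
    inside v (false , 2F) = 2 , refl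
    inside v (false , 3F) = 3 , refl
    inside v (false , 4F) = 4 , refl
    inside v (true , 4F) = 5 , refl
    inside v (true , 3F) = 6 , refl
    inside v (true , 2F) = 7 , refl
    inside v (true , 1F) = 8 , refl
    inside v (true , 0F) = 9 , refl
    cyclic : ∀ x → Orbit f (start , 0F) x
    cyclic ((v , s) , j) = orbit-trans f
      (subst (λ w → Orbit f (start , 0F) ((w , false) , 0F))
        (trans (cong gadgetAt (rot-orbit (index v))) (gadgetAt-index v)) (entry (toℕ (index v))))
      (inside v (s , j))

  module Opt = TourOf optimalRotation
  module Out = TourOf pathRotation

-- Lower bounds for matchings and tours close to the paths

module LowerBound (H : Circuit) (K : ℕ) (1≤K : 1 ≤ K) (forests : Forests K H) where
  open Circuit H
  open Gadgets H
  open Construction H K 1≤K forests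

  module On (B : Graph N) (matching : Is2Matching B) (short : ∀ u v → B u v ≡ true → length-c u v ≡ 1) where

    b : X → X → Bool
    b x y = B (to x) (to y)

    b-sym : ∀ {x y} → b x y ≡ true → b y x ≡ true
    b-sym {x} {y} e = trans (sym (proj₁ (proj₁ matching) (to x) (to y))) e

    b-adj : ∀ {x y} → b x y ≡ true → Adj x y
    b-adj {x} {y} e = subst₂ Adj (from-to x) (from-to y) (short-adj (short (to x) (to y) e))

    b-deg : ∀ {x y z w} → b x y ≡ true → b x z ≡ true → b x w ≡ true → z ≢ y → w ≢ y → w ≢ z → ⊥
    b-deg {x} e₁ e₂ e₃ n₁ n₂ n₃ = ℕₚ.<⇒≱ (count-≥3 {p = B (to x)} e₁ e₂ e₃
      (n₁ ∘ to-injective) (n₂ ∘ to-injective) (n₃ ∘ to-injective)) (proj₂ matching (to x))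

    open Matching b (λ {x} {y} → b-sym {x} {y}) b-adj b-deg loopless public

    -- With only two possible neighbours, degree 2 leaves no choice.
    both-edges : ∀ {x a a'} → deg B (to x) ≡ 2 → (∀ {y} → Adj x y → y ≡ a ⊎ y ≡ a') → b x a ≡ true
    both-edges {x} {a} {a'} deg≡2 nbrs with b x a in e
    ... | true  = refl
    ... | false = contradiction (subst (_≤ 1) deg≡2 (count-≤-length (to a' ∷ []) λ {v} → only v)) λ { (s≤s ()) }
      where
      only : ∀ v → B (to x) v ≡ true → v ∈ to a' ∷ []
      only v Bxv with nbrs (subst (λ z → Adj z (from v)) (from-to x) (short-adj (short _ _ Bxv)))
      ... | inj₁ eq = contradiction e (true≢false (subst (λ w → B (to x) w ≡ true) (trans (sym (to-from v)) (cong to eq)) Bxv))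
      ... | inj₂ eq = here (trans (sym (to-from v)) (cong to eq))

    neighbours₀ : ∀ {p y} → Adj (p , 0F) y → y ≡ (p , 4F) ⊎ y ≡ (p , 1F)
    neighbours₀ (inj₁ (side _ e01)) = inj₂ refl
    neighbours₀ (inj₁ (side _ e04)) = inj₁ refl
    neighbours₀ (inj₂ (side _ ()))

    neighbours₃ : ∀ {p y} → Adj (p , 3F) y → y ≡ (p , 4F) ⊎ y ≡ (p , 2F)
    neighbours₃ (inj₁ (side _ e34)) = inj₁ refl
    neighbours₃ (inj₂ (side _ e23)) = inj₂ refl

    -- A cycle through a whole gadget would use three edges at the end 4 of the bridge.
    cycle-split : ∀ z l → inCycle B (to (z at l)) ≡ true → Split z l
    cycle-split z l cyc = result _ _ refl refl
      where
      κ : Local → Bool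
      κ l' = conn B (to (z at l')) (to (z at l))
      preserved : ∀ l₁ l₂ → b (z at l₁) (z at l₂) ≡ true → κ l₁ ≡ κ l₂
      preserved l₁ l₂ e = bool-≡
        (λ c → conn-complete B (b-sym {z at l₁} e ◅ reachB-sound B N c))
        (λ c → conn-complete B (e ◅ reachB-sound B N c))
      respects : Respects z κ
      respects = record
        { on-side = λ s {i} {j} _ → preserved (s , i) (s , j)
        ; on-bridge = preserved (false , 4F) (true , 4F) }
      κ-l : κ l ≡ true
      κ-l = conn-complete B stop
      deg₂ : ∀ l' → κ l' ≡ true → deg B (to (z at l')) ≡ 2
      deg₂ l' κl' = two (subst (λ c → not c ∨ (deg B (to (z at l')) ≡ᵇ 2) ≡ true) κl'
        (allFin-sound cyc (to (z at l'))))
        where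
        two : ∀ {d} → (d ≡ᵇ 2) ≡ true → d ≡ 2
        two {2} _ = refl
      -- If the component of `l` misses vertex 0 or 3 of the first pentagon, then `κ` is the
      -- splitting. Otherwise both have degree 2, so both are joined to vertex 4, and there is no
      -- room for the bridge.
      result : ∀ k₀ k₃ → κ (false , 0F) ≡ k₀ → κ (false , 3F) ≡ k₃ → Split z l
      result false _     e _ = κ , respects , (false , 0F) , λ eq → true≢false (trans eq κ-l) e
      result true  false _ e = κ , respects , (false , 3F) , λ eq → true≢false (trans eq κ-l) e
      result true  true  e e' with b ((z , false) , 4F) ((z , true) , 4F) in bridge-eq
      ... | false = bridge-cut z bridge-eq l
      ... | true with b-deg
          (b-sym {(z , false) , 0F} (both-edges (deg₂ (false , 0F) e) neighbours₀))
          (b-sym {(z , false) , 3F} (both-edges (deg₂ (false , 3F) e') neighbours₃))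
          bridge-eq (λ ()) (λ ()) (λ ())
      ... | ()

    -- The set `p` contains the vertex 2 from which each used cross edge starts, and this vertex
    -- determines the edge. So at most `K` cross edges are used, and `S` lists them.
    module Few (p : Fin N → Bool) (few : countFin p ≤ K) (marks : ∀ q → Used q → p (to (q , 2F)) ≡ true) where

      used? : ∀ q → Dec (Used q)
      used? q = b (q , 2F) (next q , 1F) ≟ᵇ true

      marked : List (V × Bool)
      marked = map (proj₁ ∘ from) (trues p)

      S : List (V × Bool)
      S = filter used? marked

      S-short : length S ≤ K
      S-short = ℕₚ.≤-trans (length-filter used? marked)
        (subst (_≤ K) (sym (trans (length-map (proj₁ ∘ from) (trues p)) (length-trues p))) few)

      S-used : ∀ {q} → q ∈ S → Used q
      S-used q∈ = proj₂ (∈-filter⁻ used? {xs = marked} q∈)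

      S-covers : ∀ {q} → Used q → q ∈ S
      S-covers {q} u = ∈-filter⁺ used?
        (subst (_∈ marked) (cong proj₁ (from-to (q , 2F))) (∈-map⁺ (proj₁ ∘ from) (∈-trues p (marks q u)))) u

      open Colouring

      invariant : (c : Colouring S) → Invariant B (col c ∘ from)
      invariant c {u} {v} e = col-invariant c S-covers
        (subst₂ (λ u v → B u v ≡ true) (sym (to-from u)) (sym (to-from v)) e)

      coloured : (c : Colouring S) → Fin M → Fin N
      coloured c i = to (proj₁ (onto c (gadgetAt i)))

      coloured-col : ∀ c i → col c (from (coloured c i)) ≡ just (gadgetAt i)
      coloured-col c i = trans (cong (col c) (from-to _)) (proj₂ (onto c (gadgetAt i)))

      just-gadgetAt-injective : ∀ {i j} → just (gadgetAt i) ≡ just (gadgetAt j) → i ≡ j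
      just-gadgetAt-injective {i} {j} e =
        trans (sym (index-gadgetAt i)) (trans (cong index (just-injective e)) (index-gadgetAt j))

      c₀ : Colouring S
      c₀ = colouring forests S S-short S-used

      components-≥ : M ≤ components B
      components-≥ = colours≤components B (invariant c₀) (coloured c₀) λ {i} {j} e →
        just-gadgetAt-injective (trans (sym (coloured-col c₀ i)) (trans e (coloured-col c₀ j)))

      -- A cycle cannot span its gadget, so this gadget splits even if no cross edge meets it. Taken
      -- as root, it brings in the spare colour besides the `M` others.
      components-> : ∀ {w} → inCycle B w ≡ true → M ℕ.< components B
      components-> {w} cyc = colours≤components B (invariant cᵣ) witness witness-injective
        where
        z = gadget (from w)
        l : Local
        l = proj₂ (proj₁ (from w)) , proj₂ (from w)
        rooted = Grow.grow forests z l
          (cycle-split z l (subst (λ w → inCycle B w ≡ true) (sym (to-from w)) cyc))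
          (length S) S ℕₚ.≤-refl S-short S-used
        cᵣ = proj₁ rooted
        x₀ = proj₁ (proj₁ (proj₂ rooted))
        x₀-col : col cᵣ (from (to x₀)) ≡ nothing
        x₀-col = trans (cong (col cᵣ) (from-to x₀)) (proj₂ (proj₁ (proj₂ rooted)))
        witness : Fin (suc M) → Fin N
        witness zero    = to x₀
        witness (suc i) = coloured cᵣ i
        clash : ∀ i → col cᵣ (from (to x₀)) ≢ col cᵣ (from (coloured cᵣ i))
        clash i e with trans (sym x₀-col) (trans e (coloured-col cᵣ i))
        ... | ()
        witness-injective : ∀ {i j} → col cᵣ (from (witness i)) ≡ col cᵣ (from (witness j)) → i ≡ j
        witness-injective {zero}  {zero}  e = refl
        witness-injective {zero}  {suc j} e = contradiction e (clash j)
        witness-injective {suc i} {zero}  e = contradiction (sym e) (clash i)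
        witness-injective {suc i} {suc j} e = cong suc
          (just-gadgetAt-injective (trans (sym (coloured-col cᵣ i)) (trans e (coloured-col cᵣ j))))

  -- The edges of cost 1 in the tour form a 2-matching with few cross edges. Its colouring has `M`
  -- classes, and only edges of cost 2 can leave them.
  tour-heavy-≥ : ∀ T' → IsTour T' → (p : Fin N → Bool) → countFin p ≤ K →
    (∀ q → T' (to (q , 2F)) (to (next q , 1F)) ≡ true → p (to (q , 2F)) ≡ true) →
    M * 2 ≤ sumFin (heavy length-c T')
  tour-heavy-≥ T' tour p few marks = heavy-≥-colours length-c tour χ
    (λ {i} {j} {u} a b → just-gadgetAt-injective (trans (sym (χ-sound i u a)) (χ-sound j u b)))
    (λ i e → cong (λ k → does (k ≟ᵐ just (gadgetAt i))) (invariant c₀ e))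
    (λ i → coloured c₀ i , χ-true (coloured-col c₀ i))
    outside
    where
    B : Graph N
    B = cost1Part I T'
    sub : ∀ u v → B u v ≡ true → T' u v ≡ true × length-c u v ≡ 1
    sub u v e = proj₁ (∧-true e) , ≡ᵇ1-sound (proj₂ (∧-true {T' u v} e))
    matching : Is2Matching B
    matching = ((λ u v → cong₂ _∧_ (proj₁ (proj₁ tour) u v) (cong (_≡ᵇ 1) (c-sym I u v))) ,
                λ u → cong (_∧ (length-c u u ≡ᵇ 1)) (proj₂ (proj₁ tour) u)) ,
      λ u → subst (deg B u ≤_) (proj₁ (proj₂ tour) u) (count-mono λ v e → proj₁ (sub u v e))
    open On B matching (λ u v e → proj₂ (sub u v e))
    open Few p few (λ q u → marks q (proj₁ (sub _ _ u)))
    open Colouring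
    _≟ᵐ_ = Maybeₚ.≡-dec _≟ᵛ_
    χ : Fin M → Fin N → Bool
    χ i u = does (col c₀ (from u) ≟ᵐ just (gadgetAt i))
    χ-sound : ∀ i u → χ i u ≡ true → col c₀ (from u) ≡ just (gadgetAt i)
    χ-sound i u = does-sound (col c₀ (from u) ≟ᵐ just (gadgetAt i))
    χ-true : ∀ {i u} → col c₀ (from u) ≡ just (gadgetAt i) → χ i u ≡ true
    χ-true {i} {u} = does-true (col c₀ (from u) ≟ᵐ just (gadgetAt i))
    -- A class is left by the tour only if it is not everything; a vertex with the colour of another
    -- gadget shows this.
    outside : ∀ i → ∃ λ u → χ i u ≡ false
    outside i with another (gadgetAt i)
    ... | v , ne with onto c₀ v
    ... | x , e = to x , not-true (differs (χ i (to x)) refl)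
      where
      differs : ∀ k → χ i (to x) ≡ k → not k ≡ true
      differs false _ = refl
      differs true  t = contradiction
        (just-injective (trans (sym e) (trans (cong (col c₀) (sym (from-to x))) (χ-sound i (to x) t)))) ne

-- Subtracting `ε` lowers the left side, so the factor 11/10 itself suffices; the rest is
-- cross-multiplication in unnormalised rationals.
ratio-≤ : ∀ a b ε → 0ℚ ℚ.< ε → 11 * a ≤ 10 * b → ((ℤ.+ 11 ℚ./ 10) ℚ.- ε) ℚ.* ℕtoℚ a ℚ.≤ ℕtoℚ b
ratio-≤ a b ε ε>0 le = begin
  ((ℤ.+ 11 ℚ./ 10) ℚ.- ε) ℚ.* ℕtoℚ a ≤⟨ ℚₚ.*-monoʳ-≤-nonNeg (ℕtoℚ a) {{nonneg}} smaller ⟩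
  (ℤ.+ 11 ℚ./ 10) ℚ.* ℕtoℚ a ≤⟨ ℚₚ.toℚᵘ-cancel-≤ unnormalised ⟩
  ℕtoℚ b ∎
  where
  open ℚₚ.≤-Reasoning
  nonneg : ℚ.NonNegative (ℕtoℚ a)
  nonneg = ℚₚ.normalize-nonNeg a 1
  smaller : (ℤ.+ 11 ℚ./ 10) ℚ.- ε ℚ.≤ ℤ.+ 11 ℚ./ 10
  smaller = subst ((ℤ.+ 11 ℚ./ 10) ℚ.- ε ℚ.≤_) (ℚₚ.+-identityʳ (ℤ.+ 11 ℚ./ 10))
    (ℚₚ.+-monoʳ-≤ (ℤ.+ 11 ℚ./ 10) (ℚₚ.neg-antimono-≤ (ℚₚ.<⇒≤ ε>0)))
  unnormalised : ℚ.toℚᵘ ((ℤ.+ 11 ℚ./ 10) ℚ.* ℕtoℚ a) ℚᵘ.≤ ℚ.toℚᵘ (ℕtoℚ b)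
  unnormalised = ℚᵘₚ.≤-respˡ-≃ (ℚᵘₚ.≃-sym left) (ℚᵘₚ.≤-respʳ-≃ (ℚᵘₚ.≃-sym (ℚₚ.toℚᵘ-fromℚᵘ (ℤ.+ b ℚᵘ./ 1))) core)
    where
    left : ℚ.toℚᵘ ((ℤ.+ 11 ℚ./ 10) ℚ.* ℕtoℚ a) ℚᵘ.≃ (ℤ.+ 11 ℚᵘ./ 10) ℚᵘ.* (ℤ.+ a ℚᵘ./ 1)
    left = ℚᵘₚ.≃-trans (ℚₚ.toℚᵘ-homo-* (ℤ.+ 11 ℚ./ 10) (ℕtoℚ a))
      (ℚᵘₚ.*-congˡ {ℤ.+ 11 ℚᵘ./ 10} (ℚₚ.toℚᵘ-fromℚᵘ (ℤ.+ a ℚᵘ./ 1)))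
    core : (ℤ.+ 11 ℚᵘ./ 10) ℚᵘ.* (ℤ.+ a ℚᵘ./ 1) ℚᵘ.≤ ℤ.+ b ℚᵘ./ 1
    core = ℚᵘ.*≤* (subst₂ ℤ._≤_ (sym (trans (ℤₚ.*-identityʳ _) (sym (ℤₚ.pos-* 11 a))))
      (trans (cong ℤ.+_ (ℕₚ.*-comm 10 b)) (ℤₚ.pos-* b 10)) (ℤ.+≤+ le))

-- Vertices touched by a small change

difference-simple : ∀ {n} {A B : Graph n} → IsSimple A → IsSimple B → IsSimple (λ u v → A u v ∧ not (B u v))
difference-simple {B = B} (A-sym , A-irr) (B-sym , _) =
  (λ u v → cong₂ (λ a b → a ∧ not b) (A-sym u v) (B-sym u v)) , λ u → cong (_∧ not (B u u)) (A-irr u)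

touched : ∀ {n} → Graph n → Graph n → Fin n → Bool
touched A B u = 1 ≤ᵇ deg (λ u v → A u v ∧ not (B u v)) u

touched-true : ∀ {n} (A B : Graph n) {u v} → A u v ≡ true → B u v ≡ false → touched A B u ≡ true
touched-true A B {u} {v} a b = positive (count-≥1 {p = λ v → A u v ∧ not (B u v)} v (cong₂ (λ a b → a ∧ not b) a b))
  where
  positive : ∀ {m} → 1 ≤ m → (1 ≤ᵇ m) ≡ true
  positive (s≤s _) = refl

-- Each edge of the difference touches two vertices. This is the origin of the bound `2 * k` for the
-- forests.
touched-few : ∀ {n k} {A B : Graph n} → IsSimple A → IsSimple B → diff A B ≤ k → countFin (touched A B) ≤ 2 * k
touched-few {k = k} {A} {B} A-simple B-simple le = begin
  countFin (touched A B) ≤⟨ count-≤-sum (deg D) ⟩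
  sumFin (deg D)         ≡⟨ sum-deg D (difference-simple A-simple B-simple) ⟩
  2 * diff A B           ≤⟨ ℕₚ.*-monoʳ-≤ 2 le ⟩
  2 * k ∎
  where
  open ℕₚ.≤-Reasoning
  D = λ u v → A u v ∧ not (B u v)

-- Both tours have degree 2, so every vertex gains as many edges as it loses. A `k`-move bounds the
-- deleted edges, but the lower bound concerns the added ones.
tours-differ-equally : ∀ {n} {A B : Graph n} → IsTour A → IsTour B → diff A B ≡ diff B A
tours-differ-equally {n} {A} {B} tour-A tour-B = ℕₚ.*-cancelˡ-≡ (diff A B) (diff B A) 2 (begin
  2 * diff A B ≡⟨ sym (sum-deg _ (difference-simple (proj₁ tour-A) (proj₁ tour-B))) ⟩
  sumFin (deg (λ u v → A u v ∧ not (B u v))) ≡⟨ sum-cong row ⟩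
  sumFin (deg (λ u v → B u v ∧ not (A u v))) ≡⟨ sum-deg _ (difference-simple (proj₁ tour-B) (proj₁ tour-A)) ⟩
  2 * diff B A ∎)
  where
  open ≡-Reasoning
  row : ∀ u → deg (λ u v → A u v ∧ not (B u v)) u ≡ deg (λ u v → B u v ∧ not (A u v)) u
  row u = ℕₚ.+-cancelˡ-≡ (countFin (λ v → A u v ∧ B u v)) _ _
    (trans (sym (count-split (A u) (B u))) (trans (proj₁ (proj₂ tour-A) u)
      (trans (sym (proj₁ (proj₂ tour-B) u)) (trans (count-split (B u) (A u))
        (cong (_+ countFin (λ v → B u v ∧ not (A u v)))
          (sum-cong λ v → cong (λ a → if a then 1 else 0) (∧-comm (B u v) (A u v))))))))

-- The tour along the paths as an output of both algorithms

module Outputs (H : Circuit) (k : ℕ) (1≤2k : 1 ≤ 2 * k) (forests : Forests (2 * k) H) where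
  open Circuit H
  open Gadgets H
  open Construction H (2 * k) 1≤2k forests
  open LowerBound H (2 * k) 1≤2k forests

  T O A : Graph N
  T = Out.tour
  O = Opt.tour
  A = cost1Part I T

  open Rotation pathRotation using (f; f⁻; f-f⁻)

  short? : ∀ {x y} → Adj x y → (length-c (to x) (to y) ≡ᵇ 1) ≡ true
  short? {x} {y} a = cong (_≡ᵇ 1) (adj-short (subst₂ Adj (sym (from-to x)) (sym (from-to y)) a))

  Next : X → X → Set
  Next x y = y ≡ f x ⊎ y ≡ f⁻ x

  ends-apart : ∀ p q → ¬ Adj (p , 0F) (q , 0F)
  ends-apart p q (inj₁ (side _ ()))
  ends-apart p q (inj₂ (side _ ()))

  isEnd : X → Bool
  isEnd (_ , 0F) = true
  isEnd _        = false

  -- For an end of a path, this is the neighbour on the tour in another path or at the opposite end,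
  -- across the edge of cost 2. Elsewhere the value has no meaning.
  far : X → X
  far ((v , false) , _) = f⁻ ((v , false) , 0F)
  far ((v , true)  , _) = f ((v , true) , 0F)

  long-next : ∀ x {y} → Next x y → ¬ Adj x y → isEnd x ≡ true × y ≡ far x
  long-next ((v , false) , 0F) (inj₁ refl) na = contradiction (inj₁ (side _ e01)) na
  long-next ((v , false) , 1F) (inj₁ refl) na = contradiction (inj₁ (side _ e12)) na
  long-next ((v , false) , 2F) (inj₁ refl) na = contradiction (inj₁ (side _ e23)) na
  long-next ((v , false) , 3F) (inj₁ refl) na = contradiction (inj₁ (side _ e34)) na
  long-next ((v , false) , 4F) (inj₁ refl) na = contradiction (inj₁ (bridge v)) na
  long-next ((v , true) , 0F) (inj₁ refl) na = refl , refl
  long-next ((v , true) , 1F) (inj₁ refl) na = contradiction (inj₂ (side _ e01)) na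
  long-next ((v , true) , 2F) (inj₁ refl) na = contradiction (inj₂ (side _ e12)) na
  long-next ((v , true) , 3F) (inj₁ refl) na = contradiction (inj₂ (side _ e23)) na
  long-next ((v , true) , 4F) (inj₁ refl) na = contradiction (inj₂ (side _ e34)) na
  long-next ((v , false) , 0F) (inj₂ refl) na = refl , refl
  long-next ((v , false) , 1F) (inj₂ refl) na = contradiction (inj₂ (side _ e01)) na
  long-next ((v , false) , 2F) (inj₂ refl) na = contradiction (inj₂ (side _ e12)) na
  long-next ((v , false) , 3F) (inj₂ refl) na = contradiction (inj₂ (side _ e23)) na
  long-next ((v , false) , 4F) (inj₂ refl) na = contradiction (inj₂ (side _ e34)) na
  long-next ((v , true) , 0F) (inj₂ refl) na = contradiction (inj₁ (side _ e01)) na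
  long-next ((v , true) , 1F) (inj₂ refl) na = contradiction (inj₁ (side _ e12)) na
  long-next ((v , true) , 2F) (inj₂ refl) na = contradiction (inj₁ (side _ e23)) na
  long-next ((v , true) , 3F) (inj₂ refl) na = contradiction (inj₁ (side _ e34)) na
  long-next ((v , true) , 4F) (inj₂ refl) na = contradiction (inj₂ (bridge v)) na

  A-sound : ∀ {u v} → A u v ≡ true → Next (from u) (from v) × Adj (from u) (from v)
  A-sound {u} {v} e = Out.tour-sound u v (proj₁ (∧-true e)) , short-adj (≡ᵇ1-sound (proj₂ (∧-true {T u v} e)))

  A-succ : ∀ x → Adj x (f x) → A (to x) (to (f x)) ≡ true
  A-succ x a = cong₂ _∧_ (Out.tour-succ x) (short? a)

  A-pred : ∀ x → Adj x (f⁻ x) → A (to x) (to (f⁻ x)) ≡ true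
  A-pred x a = cong₂ _∧_ (Out.tour-pred x) (short? a)

  T-simple : IsSimple T
  T-simple = proj₁ Out.isTour

  A-simple : IsSimple A
  A-simple = (λ u v → cong₂ _∧_ (proj₁ T-simple u v) (cong (_≡ᵇ 1) (c-sym I u v))) ,
    λ u → cong (_∧ (length-c u u ≡ᵇ 1)) (proj₂ T-simple u)

  A-symmetric : ∀ {u v} → A u v ≡ true → A v u ≡ true
  A-symmetric {u} {v} e = trans (sym (proj₁ A-simple u v)) e

  first : V → Fin N
  first v = to ((v , false) , 0F)

  to-first : ∀ x → Path A (to x) (first (gadget x))
  to-first ((v , s) , i) = steps s i
    where
    path : ∀ s i → Set
    path s i = Path A (to ((v , s) , i)) (first v)
    f1 : path false 1F
    f1 = A-pred _ (inj₂ (side _ e01)) ◅ stop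
    f2 : path false 2F
    f2 = A-pred _ (inj₂ (side _ e12)) ◅ f1
    f3 : path false 3F
    f3 = A-pred _ (inj₂ (side _ e23)) ◅ f2
    f4 : path false 4F
    f4 = A-pred _ (inj₂ (side _ e34)) ◅ f3
    t4 : path true 4F
    t4 = A-pred _ (inj₂ (bridge v)) ◅ f4
    t3 : path true 3F
    t3 = A-pred _ (inj₁ (side _ e34)) ◅ t4
    t2 : path true 2F
    t2 = A-pred _ (inj₁ (side _ e23)) ◅ t3
    t1 : path true 1F
    t1 = A-pred _ (inj₁ (side _ e12)) ◅ t2
    t0 : path true 0F
    t0 = A-pred _ (inj₁ (side _ e01)) ◅ t1
    steps : ∀ s i → path s i
    steps false 0F = stop
    steps false 1F = f1
    steps false 2F = f2
    steps false 3F = f3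
    steps false 4F = f4
    steps true 0F = t0
    steps true 1F = t1
    steps true 2F = t2
    steps true 3F = t3
    steps true 4F = t4

  to-first′ : ∀ u → Path A u (first (gadget (from u)))
  to-first′ u = subst (λ w → Path A w (first (gadget (from u)))) (to-from u) (to-first (from u))

  A-reverse : ∀ {u v} → Path A u v → Path A v u
  A-reverse = reverse (λ {u} {v} → A-symmetric {u} {v})

  first-degree : ∀ v → deg A (first v) ≤ 1
  first-degree v = count-≤-length (to ((v , false) , 1F) ∷ []) λ {w} → only w
    where
    only : ∀ w → A (first v) w ≡ true → w ∈ to ((v , false) , 1F) ∷ []
    only w e with A-sound {first v} {w} e
    ... | nxt , adj with subst (λ x → Next x (from w)) (from-to _) nxt
    ... | inj₁ eq = here (trans (sym (to-from w)) (cong to eq))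
    ... | inj₂ eq = contradiction (subst₂ Adj (from-to _) eq adj) (ends-apart _ _)

  -- Every component contains the first vertex of some path, whose degree is at most 1.
  acyclic : ∀ w → inCycle A w ≢ true
  acyclic w cyc = degree (first-degree (gadget (from w)))
    (subst (λ c → not c ∨ (deg A (first (gadget (from w))) ≡ᵇ 2) ≡ true)
      (conn-complete A (A-reverse (to-first′ w))) (allFin-sound cyc (first (gadget (from w)))))
    where
    degree : ∀ {d} → d ≤ 1 → (d ≡ᵇ 2) ≢ true
    degree {0} _ ()
    degree {1} _ ()
    degree {suc (suc _)} (s≤s ()) _

  -- Every vertex is connected to the first vertex of its gadget, so each gadget accounts for at
  -- most one representative.
  components-≤ : components A ≤ M
  components-≤ = subst (components A ≤_) (trans (length-map rep (List.allFin M)) (length-tabulate {n = M} λ i → i))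
    (count-≤-length (map rep (List.allFin M)) λ {w} → listed w)
    where
    rep : Fin M → Fin N
    rep i = proj₁ (representative A (first (gadgetAt i)))
    listed : ∀ w → isRep A w ≡ true → w ∈ map rep (List.allFin M)
    listed w isrep = subst (_∈ map rep (List.allFin M)) (sym same) (∈-map⁺ rep (∈-allFin i))
      where
      i = index (gadget (from w))
      rep-isrep = proj₁ (proj₂ (representative A (first (gadgetAt i))))
      rep-path : Path A (rep i) (first (gadget (from w)))
      rep-path = subst (λ v → Path A (rep i) (first v)) (gadgetAt-index _)
        (proj₂ (proj₂ (representative A (first (gadgetAt i)))))
      between : Path A (rep i) w
      between = rep-path ◅◅ A-reverse (to-first′ w)
      same : w ≡ rep i
      same = Finₚ.toℕ-injective (ℕₚ.≤-antisym (isRep-minimal A isrep between)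
        (isRep-minimal A rep-isrep (A-reverse between)))

  -- If both tour edges at a vertex were long, they would both lead to `far`, but the two neighbours
  -- are different.
  no-singletons : singletons A ≡ 0
  no-singletons = count-none λ u → nonzero (positive u)
    where
    nonzero : ∀ {d} → 1 ≤ d → (d ≡ᵇ 0) ≡ false
    nonzero (s≤s _) = refl
    positiveˣ : ∀ x → 1 ≤ deg A (to x)
    positiveˣ x with adj? x (f x)
    ... | yes a = count-≥1 {p = A (to x)} (to (f x)) (A-succ x a)
    ... | no ¬a with adj? x (f⁻ x)
    ... | yes a = count-≥1 {p = A (to x)} (to (f⁻ x)) (A-pred x a)
    ... | no ¬a' = contradiction (trans (proj₂ (long-next x (inj₁ refl) ¬a)) (sym (proj₂ (long-next x (inj₂ refl) ¬a'))))
                     (Rotation.f-≢-f⁻ pathRotation x)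
    positive : ∀ u → 1 ≤ deg A u
    positive u = subst (λ w → 1 ≤ deg A w) (to-from u) (positiveˣ (from u))

  -- The paths stay inside the pentagons and bridges. Hence every cross edge of a modified tour or
  -- matching was added and marks its ends as touched.
  cross-new : ∀ q → T (to (q , 2F)) (to (next q , 1F)) ≡ false
  cross-new q with T (to (q , 2F)) (to (next q , 1F)) in e
  ... | false = refl
  ... | true = contradiction (subst₂ Next (from-to _) (from-to _) (Out.tour-sound _ _ e)) (not-next q)
    where
    not-next : ∀ q → ¬ Next (q , 2F) (next q , 1F)
    not-next q@(v , false) (inj₁ ())
    not-next q@(v , false) (inj₂ eq) = loopless q (sym (cong gadget eq))
    not-next q@(v , true)  (inj₁ eq) = loopless q (sym (cong gadget eq))
    not-next q@(v , true)  (inj₂ ())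

  double-cost : ∀ {T'} → IsTour T' → 2 * tourCost I T' ≡ N * 2 + sumFin (heavy length-c T')
  double-cost tour = tour-cost length-c tour (c-sym I) (c-12 I)

  -- Only the two ends of each path meet an edge of cost 2, and each of them only one.
  heavy-T : sumFin (heavy length-c T) ≤ M * 2
  heavy-T = begin
    sumFin (heavy length-c T)         ≤⟨ sum-mono (λ u → bound u (from u) refl) ⟩
    countFin (isEnd ∘ from)           ≤⟨ count-≤-length ends (λ {u} → listed u) ⟩
    length ends                       ≡⟨ trans (length-++ (map first vs)) (cong₂ _+_ (size first) (size last)) ⟩
    M + M                             ≡⟨ cong (M +_) (sym (ℕₚ.+-identityʳ M)) ⟩
    2 * M                             ≡⟨ ℕₚ.*-comm 2 M ⟩
    M * 2 ∎
    where
    open ℕₚ.≤-Reasoning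
    vs : List V
    vs = map gadgetAt (List.allFin M)
    last : V → Fin N
    last v = to ((v , true) , 0F)
    ends : List (Fin N)
    ends = map first vs ++ map last vs
    size : ∀ (g : V → Fin N) → length (map g vs) ≡ M
    size g = trans (length-map g vs) (trans (length-map gadgetAt (List.allFin M)) (length-tabulate {n = M} λ i → i))
    ∈-vs : ∀ v → v ∈ vs
    ∈-vs v = subst (_∈ vs) (gadgetAt-index v) (∈-map⁺ gadgetAt (∈-allFin (index v)))
    listed : ∀ u → isEnd (from u) ≡ true → u ∈ ends
    listed u e = subst (_∈ ends) (to-from u) (listedˣ (from u) e)
      where
      listedˣ : ∀ x → isEnd x ≡ true → to x ∈ ends
      listedˣ ((v , false) , 0F) _ = ∈-++⁺ˡ (∈-map⁺ first (∈-vs v))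
      listedˣ ((v , true)  , 0F) _ = ∈-++⁺ʳ (map first vs) (∈-map⁺ last (∈-vs v))
    heavy-next : ∀ u v → T u v ∧ not (length-c u v ≡ᵇ 1) ≡ true → isEnd (from u) ≡ true × from v ≡ far (from u)
    heavy-next u v e = long-next (from u) (Out.tour-sound u v (proj₁ (∧-true e))) λ a →
      contradiction (not-true (proj₂ (∧-true {T u v} e))) (true≢false (cong (_≡ᵇ 1) (adj-short {u} {v} a)))
    bound : ∀ u x → from u ≡ x → heavy length-c T u ≤ (if isEnd x then 1 else 0)
    bound u x refl with isEnd (from u) in e
    ... | true  = count-≤-length (to (far (from u)) ∷ []) λ {v} h →
      here (trans (sym (to-from v)) (cong to (proj₂ (heavy-next u v h))))
    ... | false = count-≤-length [] λ {v} h → contradiction e (true≢false (proj₁ (heavy-next u v h)))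

  heavy-O : sumFin (heavy length-c O) ≡ 0
  heavy-O = trans (sum-cong λ u → count-none (none u)) (trans (sum-const N 0) (ℕₚ.*-zeroʳ N))
    where
    open Rotation optimalRotation renaming (f to g; f⁻ to g⁻; f-f⁻ to g-g⁻) using ()
    adj-g : ∀ x → Adj x (g x)
    adj-g (p , 0F) = inj₁ (side p e04)
    adj-g (p , 1F) = inj₂ (side p e01)
    adj-g (p , 2F) = inj₁ (cross p)
    adj-g (p , 3F) = inj₂ (side p e23)
    adj-g (p , 4F) = inj₂ (side p e34)
    adj : ∀ x y → y ≡ g x ⊎ y ≡ g⁻ x → Adj x y
    adj x _ (inj₁ refl) = adj-g x
    adj x _ (inj₂ refl) = Adj-sym (subst (Adj (g⁻ x)) (g-g⁻ x) (adj-g (g⁻ x)))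
    none : ∀ u v → O u v ∧ not (length-c u v ≡ᵇ 1) ≡ false
    none u v with O u v in e
    ... | false = refl
    ... | true  = cong (λ m → not (m ≡ᵇ 1)) (adj-short {u} {v} (adj _ _ (Opt.tour-sound u v e)))

  cost-O : tourCost I O ≡ N
  cost-O = ℕₚ.*-cancelˡ-≡ _ N 2 (trans (double-cost Opt.isTour)
    (trans (cong (N * 2 +_) heavy-O) (trans (ℕₚ.+-identityʳ (N * 2)) (ℕₚ.*-comm N 2))))

  optimal : ∀ T' → IsTour T' → tourCost I O ≤ tourCost I T'
  optimal T' tour = ℕₚ.*-cancelˡ-≤ 2 (begin
    2 * tourCost I O ≡⟨ cong (2 *_) cost-O ⟩
    2 * N ≡⟨ ℕₚ.*-comm 2 N ⟩
    N * 2 ≤⟨ ℕₚ.m≤m+n _ _ ⟩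
    N * 2 + sumFin (heavy length-c T') ≡⟨ sym (double-cost tour) ⟩
    2 * tourCost I T' ∎)
    where open ℕₚ.≤-Reasoning

  -- Local optimality

  module _ {T' : Graph N} (tour' : IsTour T') (close : diff T T' ≤ k) where

    -- As many edges are added as deleted, so at most `2 * k` vertices are touched and at most that
    -- many cross edges are used.
    double-cost-≥ : N * 2 + M * 2 ≤ 2 * tourCost I T'
    double-cost-≥ = subst (N * 2 + M * 2 ≤_) (sym (double-cost tour'))
      (ℕₚ.+-monoʳ-≤ (N * 2) (tour-heavy-≥ T' tour' (touched T' T)
        (touched-few (proj₁ tour') T-simple (subst (_≤ k) (tours-differ-equally Out.isTour tour') close))
        λ q e → touched-true T' T e (cross-new q)))

    T-cheapest : tourCost I T ≤ tourCost I T'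
    T-cheapest = ℕₚ.*-cancelˡ-≤ 2 (begin
      2 * tourCost I T ≡⟨ double-cost Out.isTour ⟩
      N * 2 + sumFin (heavy length-c T) ≤⟨ ℕₚ.+-monoʳ-≤ (N * 2) heavy-T ⟩
      N * 2 + M * 2 ≤⟨ double-cost-≥ ⟩
      2 * tourCost I T' ∎)
      where open ℕₚ.≤-Reasoning

  kOptimal : KOptimal I k T
  kOptimal = Out.isTour , λ T' (tour' , close) cheaper → ℕₚ.<⇒≱ cheaper (T-cheapest tour' close)

  -- The matching `A` has at most `M` components, no cycles and no singletons. Fewer components are
  -- excluded by `components-≥`; a cycle in `B` forces more than `M` components; and the number of
  -- singletons cannot drop below 0.
  not-improvable : ∀ B → ¬ ImprovingMove I k A B
  not-improvable B (matching , close , short , better) = worse better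
    where
    open On B matching short
    open Few (touched B A)
      (touched-few (proj₁ matching) A-simple (ℕₚ.≤-trans (ℕₚ.m≤n+m _ _) close))
      (λ q u → touched-true B A u (cong (_∧ (length-c (to (q , 2F)) (to (next q , 1F)) ≡ᵇ 1)) (cross-new q)))
    worse : ¬ Better A B
    worse (inj₁ fewer) = ℕₚ.<⇒≱ fewer (ℕₚ.≤-trans components-≤ components-≥)
    worse (inj₂ (inj₁ (same , more))) with count-pos _ (ℕₚ.≤-trans (s≤s z≤n) more)
    ... | w , e = ℕₚ.<⇒≱ (components-> (proj₂ (∧-true {isRep B w} e))) (subst (_≤ M) (sym same) components-≤)
    worse (inj₂ (inj₂ (_ , _ , fewer))) with subst (singletons B ℕ.<_) no-singletons fewer
    ... | ()

  -- Started from `T`, the algorithm makes no step. As `A` has no cycle, nothing is removed, and the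
  -- paths can be reconnected to `T` itself.
  improvOutput : ImprovOutput I k T
  improvOutput = T , Out.isTour , A , done , not-improvable , (λ _ _ → false) ,
    ((λ _ _ → refl) , (λ _ _ ()) , (λ _ _ ()) , λ w cyc → contradiction cyc (acyclic w)) ,
    Out.isTour , λ u v e _ → proj₁ (∧-true e)

  diff-self : ∀ (G : Graph N) → diff G G ≡ 0
  diff-self G = trans (sum-cong λ u → trans (sum-cong (entry u)) zeros) zeros
    where
    zeros : sumFin {N} (λ _ → 0) ≡ 0
    zeros = trans (sum-const N 0) (ℕₚ.*-zeroʳ N)
    entry : ∀ u v → (if (toℕ u <ᵇ toℕ v) ∧ (G u v ∧ not (G u v)) then 1 else 0) ≡ 0
    entry u v with toℕ u <ᵇ toℕ v | G u v
    ... | false | _     = refl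
    ... | true  | true  = refl
    ... | true  | false = refl

  -- The lower bound for tours close to `T` also applies to `T`, which differs from itself in no
  -- edge: its length is at least 11 `M`, against the optimum 10 `M`.
  cost-ratio : 11 * tourCost I O ≤ 10 * tourCost I T
  cost-ratio = ℕₚ.*-cancelˡ-≤ 2 (begin
    2 * (11 * tourCost I O) ≡⟨ cong (λ m → 2 * (11 * m)) (trans cost-O N≡) ⟩
    2 * (11 * (M * 2 * 5)) ≡⟨ solve 1 (λ m → con 2 :* (con 11 :* (m :* con 2 :* con 5)) :=
                                con 10 :* (m :* con 2 :* con 5 :* con 2 :+ m :* con 2)) refl M ⟩
    10 * (M * 2 * 5 * 2 + M * 2) ≡⟨ cong (λ n → 10 * (n * 2 + M * 2)) (sym N≡) ⟩
    10 * (N * 2 + M * 2) ≤⟨ ℕₚ.*-monoʳ-≤ 10 (double-cost-≥ Out.isTour (subst (_≤ k) (sym (diff-self T)) z≤n)) ⟩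
    10 * (2 * tourCost I T) ≡⟨ solve 1 (λ t → con 10 :* (con 2 :* t) := con 2 :* (con 10 :* t)) refl (tourCost I T) ⟩
    2 * (10 * tourCost I T) ∎)
    where
    open ℕₚ.≤-Reasoning
    open +-*-Solver

  ratio : ∀ ε → 0ℚ ℚ.< ε → RatioAtLeast I T ε
  ratio ε ε>0 = O , Opt.isTour , optimal , ratio-≤ (tourCost I O) (tourCost I T) ε ε>0 cost-ratio

theorem10 : (k : ℕ) → 1 ≤ k → (ε : ℚ) → 0ℚ < ε →
    (Σ Instance λ I → Σ (Graph (n I)) λ T → KOptimal I k T × RatioAtLeast I T ε) ×
    (Σ Instance λ I → Σ (Graph (n I)) λ T → ImprovOutput I k T × RatioAtLeast I T ε)
theorem10 k 1≤k ε ε>0 = (I , T , kOptimal , ratio ε ε>0) , (I , T , improvOutput , ratio ε ε>0)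
  where
  girth : Σ Circuit (Forests (2 * k))
  girth = high-girth (2 * k)
  open Construction (proj₁ girth) (2 * k) (ℕₚ.≤-trans 1≤k (ℕₚ.m≤n*m k 2)) (proj₂ girth)
  open Outputs (proj₁ girth) k (ℕₚ.≤-trans 1≤k (ℕₚ.m≤n*m k 2)) (proj₂ girth)
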